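{- Let $G=\mathrm{srg}(n,k,\lambda,\mu)$ be a strongly regular graph with $\mu\ge1$. Then \[ \mathrm{QEC}(G)=-2-\frac{\lambda-\mu-\sqrt{(\lambda-\mu)^2+4(k-\mu)}}{2}. \]
   Context: A graph $G=(V,E)$ is finite and simple. It is strongly regular with parameters $\mathrm{srg}(n,k,\lambda,\mu)$ if $|V|=n$, every vertex has exactly $k$ neighbours, every two adjacent vertices have exactly $\lambda$ common neighbours, and every two distinct non-adjacent vertices have exactly $\mu$ common neighbours. The hypothesis $\mu\ge1$ means in particular that there exist distinct non-adjacent vertices (so $G$ is not complete) and that $G$ is connected. For a connected graph $G=(V,E)$ with $|V|\ge2$, let $D=[d(x,y)]_{x,y\in V}$ be its distance matrix ($d$ the graph distance), and define the quadratic embedding constant \[ \mathrm{QEC}(G)=\max\{\langle f,Df\rangle : f\in\mathbb{R}^V,\ \langle f,f\rangle=1,\ \langle \mathbf{1},f\rangle=0\}, \] where $\mathbf 1$ is the all-ones vector and $\langle\cdot,\cdot\rangle$ the standard inner product. -}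

module Defs where

open import Algebra.Bundles using (RawMonoid)
open import Data.Fin.Base using (Fin)
open import Data.Fin.Properties using (any?) renaming (_≟_ to _≟ᶠ_)
open import Data.Fin.Subset using (Subset; _∩_; ∣_∣; _∈_)
open import Data.Fin.Subset.Properties using (nonempty?; Empty-unique; ∣⊥∣≡0; x∈p∩q⁻)
open import Data.Integer.Base using (+_)
import Data.Integer.Base as ℤ
import Data.Integer.Properties as ℤP
open import Data.Nat.Base as ℕ using (ℕ; zero; suc; z≤n; s≤s)
import Data.Nat.Properties as ℕP
open import Data.Product.Base using (_×_; _,_; ∃; ∃₂; proj₁; proj₂)
open import Data.Rational.Base as ℚ using (ℚ; 0ℚ; 1ℚ; ½; ↥_; ↧ₙ_)
import Data.Rational.Properties as ℚP
import Data.Rational.Unnormalised.Base as ℚᵘ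
import Data.Rational.Unnormalised.Properties as ℚᵘP
open import Data.Rational.Solver using (module +-*-Solver)
open import Data.Sum.Base using (inj₁; inj₂)
open import Data.Vec.Base using (tabulate)
open import Data.Vec.Properties using (lookup∘tabulate; []=⇒lookup)
open import Function.Base using (_∘_)
open import Level using (0ℓ)
open import Relation.Binary.Core using (Rel)
open import Relation.Binary.Definitions using (Decidable; Symmetric; Irreflexive)
open import Relation.Binary.PropositionalEquality using (_≡_; _≢_; refl; sym; trans; cong; cong₂; subst; subst₂)
open import Relation.Nullary.Decidable using (Dec; yes; no; does; map′; _×-dec_)
open import Relation.Nullary.Negation using (¬_; contradiction)
import Relation.Unary as U

open +-*-Solver using (solve; _:+_; _:*_; :-_; _:-_; _:=_; con)

<⇒∣∣< : ∀ {p e} → p ℚ.< e → ℚ.- p ℚ.< e → ℚ.∣ p ∣ ℚ.< e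
<⇒∣∣< {p} h₁ h₂ with ℚP.∣p∣≡p∨∣p∣≡-p p
... | inj₁ eq = subst (ℚ._< _) (sym eq) h₁
... | inj₂ eq = subst (ℚ._< _) (sym eq) h₂

p≤∣p∣ : ∀ p → p ℚ.≤ ℚ.∣ p ∣
p≤∣p∣ p with ℚP.≤-total 0ℚ p
... | inj₁ 0≤p = ℚP.≤-reflexive (sym (ℚP.0≤p⇒∣p∣≡p 0≤p))
... | inj₂ p≤0 = ℚP.≤-trans p≤0 (ℚP.0≤∣p∣ p)

∣p-q∣-comm : ∀ p q → ℚ.∣ p ℚ.- q ∣ ≡ ℚ.∣ q ℚ.- p ∣
∣p-q∣-comm p q = trans (sym (ℚP.∣-p∣≡∣p∣ (p ℚ.- q)))
  (cong ℚ.∣_∣ (solve 2 (λ p q → :- (p :- q) := q :- p) refl p q))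

*-mono-≤ : ∀ {p q r s} → 0ℚ ℚ.≤ q → 0ℚ ℚ.≤ r → p ℚ.≤ q → r ℚ.≤ s → p ℚ.* r ℚ.≤ q ℚ.* s
*-mono-≤ {q = q} {r = r} 0≤q 0≤r p≤q r≤s = ℚP.≤-trans
  (ℚP.*-monoʳ-≤-nonNeg r {{ℚ.nonNegative 0≤r}} p≤q)
  (ℚP.*-monoˡ-≤-nonNeg q {{ℚ.nonNegative 0≤q}} r≤s)

*-pos : ∀ {p q} → 0ℚ ℚ.< p → 0ℚ ℚ.< q → 0ℚ ℚ.< p ℚ.* q
*-pos {p} {q} 0<p 0<q = subst (ℚ._< p ℚ.* q) (ℚP.*-zeroˡ q)
  (ℚP.*-monoˡ-<-pos q {{ℚ.positive 0<q}} 0<p)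

+-nonneg : ∀ {p q} → 0ℚ ℚ.≤ p → 0ℚ ℚ.≤ q → 0ℚ ℚ.≤ p ℚ.+ q
+-nonneg = ℚP.+-mono-≤

half-pos : ∀ {ε} → 0ℚ ℚ.< ε → 0ℚ ℚ.< ε ℚ.* ½
half-pos 0<ε = *-pos 0<ε (ℚP.positive⁻¹ ½)

half+half : ∀ ε → ε ℚ.* ½ ℚ.+ ε ℚ.* ½ ≡ ε
half+half = solve 1 (λ e → e :* con ½ :+ e :* con ½ := e) refl

sq-cancel-< : ∀ {p q} → 0ℚ ℚ.≤ q → p ℚ.* p ℚ.< q ℚ.* q → p ℚ.< q
sq-cancel-< {p} {q} 0≤q h with q ℚP.≤? p
... | yes q≤p = contradiction
  (ℚP.<-≤-trans h (*-mono-≤ (ℚP.≤-trans 0≤q q≤p) 0≤q q≤p q≤p)) (ℚP.<-irrefl refl)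
... | no  q≰p = ℚP.≰⇒> q≰p

ℕ→ℚ : ℕ → ℚ
ℕ→ℚ n = + n ℚ./ 1

toℚᵘ-/ : ∀ i d .{{_ : ℕ.NonZero d}} → ℚ.toℚᵘ (i ℚ./ d) ℚᵘ.≃ i ℚᵘ./ d
toℚᵘ-/ i (suc d) = ℚP.toℚᵘ-fromℚᵘ (ℚᵘ.mkℚᵘ i d)

ℕ→ℚ-* : ∀ m n → ℕ→ℚ (m ℕ.* n) ≡ ℕ→ℚ m ℚ.* ℕ→ℚ n
ℕ→ℚ-* m n = ℚP.toℚᵘ-injective (begin
  ℚ.toℚᵘ (ℕ→ℚ (m ℕ.* n))                 ≈⟨ toℚᵘ-/ (+ (m ℕ.* n)) 1 ⟩
  + (m ℕ.* n) ℚᵘ./ 1                      ≈⟨ ℚᵘ.*≡* (cong (ℤ._* + 1) (ℤP.pos-* m n)) ⟩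
  (+ m ℚᵘ./ 1) ℚᵘ.* (+ n ℚᵘ./ 1)          ≈⟨ ℚᵘP.*-cong (toℚᵘ-/ (+ m) 1) (toℚᵘ-/ (+ n) 1) ⟨
  ℚ.toℚᵘ (ℕ→ℚ m) ℚᵘ.* ℚ.toℚᵘ (ℕ→ℚ n)    ≈⟨ ℚP.toℚᵘ-homo-* (ℕ→ℚ m) (ℕ→ℚ n) ⟨
  ℚ.toℚᵘ (ℕ→ℚ m ℚ.* ℕ→ℚ n)              ∎)
  where open ℚᵘP.≃-Reasoning

ℕ→ℚ-+ : ∀ m n → ℕ→ℚ (m ℕ.+ n) ≡ ℕ→ℚ m ℚ.+ ℕ→ℚ n
ℕ→ℚ-+ m n = ℚP.toℚᵘ-injective (begin
  ℚ.toℚᵘ (ℕ→ℚ (m ℕ.+ n))                 ≈⟨ toℚᵘ-/ (+ (m ℕ.+ n)) 1 ⟩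
  + (m ℕ.+ n) ℚᵘ./ 1                      ≈⟨ ℚᵘ.*≡* (cong (ℤ._* + 1) (trans (ℤP.pos-+ m n)
                                              (cong₂ ℤ._+_ (sym (ℤP.*-identityʳ (+ m))) (sym (ℤP.*-identityʳ (+ n)))))) ⟩
  (+ m ℚᵘ./ 1) ℚᵘ.+ (+ n ℚᵘ./ 1)          ≈⟨ ℚᵘP.+-cong (toℚᵘ-/ (+ m) 1) (toℚᵘ-/ (+ n) 1) ⟨
  ℚ.toℚᵘ (ℕ→ℚ m) ℚᵘ.+ ℚ.toℚᵘ (ℕ→ℚ n)    ≈⟨ ℚP.toℚᵘ-homo-+ (ℕ→ℚ m) (ℕ→ℚ n) ⟨
  ℚ.toℚᵘ (ℕ→ℚ m ℚ.+ ℕ→ℚ n)              ∎)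
  where open ℚᵘP.≃-Reasoning

/-cancel : ∀ i d .{{_ : ℕ.NonZero d}} → (i ℚ./ d) ℚ.* ℕ→ℚ d ≡ i ℚ./ 1
/-cancel i (suc d) = ℚP.toℚᵘ-injective (begin
  ℚ.toℚᵘ ((i ℚ./ suc d) ℚ.* ℕ→ℚ (suc d))            ≈⟨ ℚP.toℚᵘ-homo-* (i ℚ./ suc d) (ℕ→ℚ (suc d)) ⟩
  ℚ.toℚᵘ (i ℚ./ suc d) ℚᵘ.* ℚ.toℚᵘ (ℕ→ℚ (suc d))   ≈⟨ ℚᵘP.*-cong (toℚᵘ-/ i (suc d)) (toℚᵘ-/ (+ suc d) 1) ⟩
  (i ℚᵘ./ suc d) ℚᵘ.* (+ suc d ℚᵘ./ 1)               ≈⟨ ℚᵘ.*≡* (trans (ℤP.*-identityʳ (i ℤ.* + suc d))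
                                                         (cong (λ e → i ℤ.* + e) (sym (ℕP.*-identityʳ (suc d))))) ⟩
  i ℚᵘ./ 1                                           ≈⟨ toℚᵘ-/ i 1 ⟨
  ℚ.toℚᵘ (i ℚ./ 1)                                   ∎)
  where open ℚᵘP.≃-Reasoning

ℕ→ℚ-nonneg : ∀ n → 0ℚ ℚ.≤ ℕ→ℚ n
ℕ→ℚ-nonneg n = ℚP.toℚᵘ-cancel-≤ (ℚᵘP.≤-respʳ-≃ (ℚᵘP.≃-sym (toℚᵘ-/ (+ n) 1))
  (ℚᵘ.*≤* (subst (+ 0 ℤ.≤_) (sym (ℤP.*-identityʳ (+ n))) (ℤ.+≤+ z≤n))))

ℕ→ℚ-mono-≤ : ∀ {m n} → m ℕ.≤ n → ℕ→ℚ m ℚ.≤ ℕ→ℚ n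
ℕ→ℚ-mono-≤ {m} {n} m≤n = subst₂ ℚ._≤_ (ℚP.+-identityʳ (ℕ→ℚ m))
  (trans (sym (ℕ→ℚ-+ m (n ℕ.∸ m))) (cong ℕ→ℚ (ℕP.m+[n∸m]≡n m≤n)))
  (ℚP.+-monoʳ-≤ (ℕ→ℚ m) (ℕ→ℚ-nonneg (n ℕ.∸ m)))

ℕ→ℚ-mono-< : ∀ {m n} → m ℕ.< n → ℕ→ℚ m ℚ.< ℕ→ℚ n
ℕ→ℚ-mono-< {m} {n} m<n = ℚP.<-≤-trans
  (subst₂ ℚ._<_ (ℚP.+-identityˡ (ℕ→ℚ m)) (sym (ℕ→ℚ-+ 1 m))
    (ℚP.+-monoˡ-< (ℕ→ℚ m) (ℚP.positive⁻¹ 1ℚ)))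
  (ℕ→ℚ-mono-≤ m<n)

archimedean : ∀ {ε} → 0ℚ ℚ.< ε → ∃ λ N → ∀ n → N ℕ.≤ n → + 1 ℚ./ suc n ℚ.< ε
archimedean {ε} 0<ε = ↧ₙ ε , λ n d≤n →
  ℚP.*-cancelʳ-<-nonNeg (ℕ→ℚ (suc n)) {{ℚ.nonNegative (ℕ→ℚ-nonneg (suc n))}} (begin-strict
    (+ 1 ℚ./ suc n) ℚ.* ℕ→ℚ (suc n)  ≡⟨ /-cancel (+ 1) (suc n) ⟩
    1ℚ                               ≤⟨ 1≤↥ ⟩
    ↥ ε ℚ./ 1                        ≡⟨ /-cancel (↥ ε) (↧ₙ ε) ⟨
    (↥ ε ℚ./ ↧ₙ ε) ℚ.* ℕ→ℚ (↧ₙ ε)   ≡⟨ cong (ℚ._* ℕ→ℚ (↧ₙ ε)) (ℚP.↥p/↧p≡p ε) ⟩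
    ε ℚ.* ℕ→ℚ (↧ₙ ε)                 <⟨ ℚP.*-monoʳ-<-pos ε {{ℚ.positive 0<ε}} (ℕ→ℚ-mono-< (s≤s d≤n)) ⟩
    ε ℚ.* ℕ→ℚ (suc n)                ∎)
  where
  open ℚP.≤-Reasoning
  1≤ : ∀ p → ℚ.Positive p → 1ℚ ℚ.≤ ↥ p ℚ./ 1
  1≤ (ℚ.mkℚ (+ suc k) _ _) _ = ℕ→ℚ-mono-≤ {1} {suc k} (s≤s z≤n)
  1≤↥ : 1ℚ ℚ.≤ ↥ ε ℚ./ 1
  1≤↥ = 1≤ ε (ℚ.positive 0<ε)

-- The real numbers: Cauchy sequences of rationals, with _≃_ (difference
-- tending to 0) as equality.

record ℝ : Set where
  constructor mkℝ
  field
    seq    : ℕ → ℚ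
    cauchy : ∀ ε → 0ℚ ℚ.< ε →
             ∃ λ N → ∀ m n → N ℕ.≤ m → N ℕ.≤ n → ℚ.∣ seq m ℚ.- seq n ∣ ℚ.< ε

open ℝ public

infix 4 _≃_ _≤_

_≃_ : Rel ℝ 0ℓ
x ≃ y = ∀ ε → 0ℚ ℚ.< ε → ∃ λ N → ∀ n → N ℕ.≤ n → ℚ.∣ seq x n ℚ.- seq y n ∣ ℚ.< ε

_≤_ : Rel ℝ 0ℓ
x ≤ y = ∀ ε → 0ℚ ℚ.< ε → ∃ λ N → ∀ n → N ℕ.≤ n → seq x n ℚ.< seq y n ℚ.+ ε

fromℚ : ℚ → ℝ
fromℚ q = mkℝ (λ _ → q) λ ε 0<ε → 0 , λ _ _ _ _ →
  subst (ℚ._< ε) (sym (cong ℚ.∣_∣ (ℚP.+-inverseʳ q))) 0<ε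

fromℕ : ℕ → ℝ
fromℕ n = fromℚ (ℕ→ℚ n)

infixl 6 _+_ _-_
infixl 7 _*_
infix  8 -_ √_

_+_ : ℝ → ℝ → ℝ
x + y = mkℝ (λ n → seq x n ℚ.+ seq y n) λ ε 0<ε →
  let M , hx = cauchy x (ε ℚ.* ½) (half-pos 0<ε)
      N , hy = cauchy y (ε ℚ.* ½) (half-pos 0<ε)
  in M ℕ.+ N , λ m n m≥ n≥ → begin-strict
    ℚ.∣ (seq x m ℚ.+ seq y m) ℚ.- (seq x n ℚ.+ seq y n) ∣
      ≡⟨ cong ℚ.∣_∣ (solve 4 (λ a b c d → (a :+ b) :- (c :+ d) := (a :- c) :+ (b :- d)) refl
           (seq x m) (seq y m) (seq x n) (seq y n)) ⟩
    ℚ.∣ (seq x m ℚ.- seq x n) ℚ.+ (seq y m ℚ.- seq y n) ∣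
      ≤⟨ ℚP.∣p+q∣≤∣p∣+∣q∣ (seq x m ℚ.- seq x n) (seq y m ℚ.- seq y n) ⟩
    ℚ.∣ seq x m ℚ.- seq x n ∣ ℚ.+ ℚ.∣ seq y m ℚ.- seq y n ∣
      <⟨ ℚP.+-mono-< (hx m n (ℕP.m+n≤o⇒m≤o M m≥) (ℕP.m+n≤o⇒m≤o M n≥))
                     (hy m n (ℕP.m+n≤o⇒n≤o M m≥) (ℕP.m+n≤o⇒n≤o M n≥)) ⟩
    ε ℚ.* ½ ℚ.+ ε ℚ.* ½
      ≡⟨ half+half ε ⟩
    ε ∎
  where open ℚP.≤-Reasoning

-_ : ℝ → ℝ
- x = mkℝ (λ n → ℚ.- seq x n) λ ε 0<ε →
  let N , h = cauchy x ε 0<ε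
  in N , λ m n m≥ n≥ → subst (ℚ._< ε)
    (trans (∣p-q∣-comm (seq x m) (seq x n))
      (cong ℚ.∣_∣ (solve 2 (λ a b → b :- a := :- a :- :- b) refl (seq x m) (seq x n))))
    (h m n m≥ n≥)

_-_ : ℝ → ℝ → ℝ
x - y = x + - y

bounded : ∀ x → ∃₂ λ B N → 0ℚ ℚ.< B × (∀ n → N ℕ.≤ n → ℚ.∣ seq x n ∣ ℚ.≤ B)
bounded x =
  let N , h = cauchy x 1ℚ (ℚP.positive⁻¹ 1ℚ)
      a = seq x N
  in ℚ.∣ a ∣ ℚ.+ 1ℚ , N
   , ℚP.+-mono-≤-< (ℚP.0≤∣p∣ a) (ℚP.positive⁻¹ 1ℚ)
   , λ n n≥ → begin
       ℚ.∣ seq x n ∣                        ≡⟨ cong ℚ.∣_∣ (solve 2 (λ a b → b := a :+ (b :- a)) refl a (seq x n)) ⟩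
       ℚ.∣ a ℚ.+ (seq x n ℚ.- a) ∣          ≤⟨ ℚP.∣p+q∣≤∣p∣+∣q∣ a (seq x n ℚ.- a) ⟩
       ℚ.∣ a ∣ ℚ.+ ℚ.∣ seq x n ℚ.- a ∣      ≤⟨ ℚP.+-monoʳ-≤ ℚ.∣ a ∣ (ℚP.<⇒≤ (h n N n≥ ℕP.≤-refl)) ⟩
       ℚ.∣ a ∣ ℚ.+ 1ℚ                       ∎
  where open ℚP.≤-Reasoning

_*_ : ℝ → ℝ → ℝ
x * y = mkℝ (λ n → seq x n ℚ.* seq y n) λ ε 0<ε →
  let A , K , 0<A , hA = bounded x
      B , L , 0<B , hB = bounded y
      0<C = ℚP.+-mono-< 0<A 0<B
      instance
        posC = ℚ.positive 0<C
        nzC  = ℚP.pos⇒nonZero (A ℚ.+ B)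
      δ   = ε ℚ.* ℚ.1/ (A ℚ.+ B)
      0<δ = *-pos 0<ε (ℚP.positive⁻¹ (ℚ.1/ (A ℚ.+ B)) {{ℚP.1/pos⇒pos (A ℚ.+ B)}})
      M , hx = cauchy x δ 0<δ
      N , hy = cauchy y δ 0<δ
  in (K ℕ.+ L) ℕ.+ (M ℕ.+ N) , λ m n m≥ n≥ →
    let m≥K+L = ℕP.m+n≤o⇒m≤o (K ℕ.+ L) m≥
        n≥K+L = ℕP.m+n≤o⇒m≤o (K ℕ.+ L) n≥
        m≥M+N = ℕP.m+n≤o⇒n≤o (K ℕ.+ L) m≥
        n≥M+N = ℕP.m+n≤o⇒n≤o (K ℕ.+ L) n≥
        a = seq x m ; b = seq y m ; c = seq x n ; d = seq y n
    in begin-strict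
    ℚ.∣ a ℚ.* b ℚ.- c ℚ.* d ∣
      ≡⟨ cong ℚ.∣_∣ (solve 4 (λ a b c d → a :* b :- c :* d := a :* (b :- d) :+ d :* (a :- c)) refl a b c d) ⟩
    ℚ.∣ a ℚ.* (b ℚ.- d) ℚ.+ d ℚ.* (a ℚ.- c) ∣
      ≤⟨ ℚP.∣p+q∣≤∣p∣+∣q∣ (a ℚ.* (b ℚ.- d)) (d ℚ.* (a ℚ.- c)) ⟩
    ℚ.∣ a ℚ.* (b ℚ.- d) ∣ ℚ.+ ℚ.∣ d ℚ.* (a ℚ.- c) ∣
      ≡⟨ cong₂ ℚ._+_ (ℚP.∣p*q∣≡∣p∣*∣q∣ a (b ℚ.- d)) (ℚP.∣p*q∣≡∣p∣*∣q∣ d (a ℚ.- c)) ⟩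
    ℚ.∣ a ∣ ℚ.* ℚ.∣ b ℚ.- d ∣ ℚ.+ ℚ.∣ d ∣ ℚ.* ℚ.∣ a ℚ.- c ∣
      ≤⟨ ℚP.+-mono-≤
           (ℚP.*-monoʳ-≤-nonNeg ℚ.∣ b ℚ.- d ∣ {{ℚP.∣-∣-nonNeg (b ℚ.- d)}} (hA m (ℕP.m+n≤o⇒m≤o K m≥K+L)))
           (ℚP.*-monoʳ-≤-nonNeg ℚ.∣ a ℚ.- c ∣ {{ℚP.∣-∣-nonNeg (a ℚ.- c)}} (hB n (ℕP.m+n≤o⇒n≤o K n≥K+L))) ⟩
    A ℚ.* ℚ.∣ b ℚ.- d ∣ ℚ.+ B ℚ.* ℚ.∣ a ℚ.- c ∣
      <⟨ ℚP.+-mono-<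
           (ℚP.*-monoʳ-<-pos A {{ℚ.positive 0<A}} (hy m n (ℕP.m+n≤o⇒n≤o M m≥M+N) (ℕP.m+n≤o⇒n≤o M n≥M+N)))
           (ℚP.*-monoʳ-<-pos B {{ℚ.positive 0<B}} (hx m n (ℕP.m+n≤o⇒m≤o M m≥M+N) (ℕP.m+n≤o⇒m≤o M n≥M+N))) ⟩
    A ℚ.* δ ℚ.+ B ℚ.* δ
      ≡⟨ solve 4 (λ A B e i → A :* (e :* i) :+ B :* (e :* i) := e :* ((A :+ B) :* i)) refl A B ε (ℚ.1/ (A ℚ.+ B)) ⟩
    ε ℚ.* ((A ℚ.+ B) ℚ.* ℚ.1/ (A ℚ.+ B))
      ≡⟨ cong (ε ℚ.*_) (ℚP.*-inverseʳ (A ℚ.+ B)) ⟩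
    ε ℚ.* 1ℚ
      ≡⟨ ℚP.*-identityʳ ε ⟩
    ε ∎
  where open ℚP.≤-Reasoning

-- ⌊√ n⌋
isqrt : ℕ → ℕ
isqrt zero    = 0
isqrt (suc n) with suc (isqrt n) ℕ.* suc (isqrt n) ℕP.≤? suc n
... | yes _ = suc (isqrt n)
... | no  _ = isqrt n

isqrt-spec : ∀ n → isqrt n ℕ.* isqrt n ℕ.≤ n × n ℕ.< suc (isqrt n) ℕ.* suc (isqrt n)
isqrt-spec zero = z≤n , s≤s z≤n
isqrt-spec (suc n) with suc (isqrt n) ℕ.* suc (isqrt n) ℕP.≤? suc n
... | yes p = p , ℕP.≤-<-trans (proj₂ (isqrt-spec n)) (ℕP.*-mono-< (ℕP.n<1+n r) (ℕP.n<1+n r))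
  where r = suc (isqrt n)
... | no ¬p = ℕP.m≤n⇒m≤1+n (proj₁ (isqrt-spec n)) , ℕP.≰⇒> ¬p

-- With q⁺ = max(q, 0) = a / d and m = n + 1, this is ⌊√(a d m²)⌋ / (d m),
-- a rational s ≥ 0 with s² ≤ q⁺ < (s + 1/m)².
√ℚ : ℕ → ℚ → ℚ
√ℚ n q =
  let q⁺ = q ℚ.⊔ 0ℚ
      m  = suc n
  in + isqrt (ℤ.∣ ↥ q⁺ ∣ ℕ.* ↧ₙ q⁺ ℕ.* (m ℕ.* m)) ℚ./ (↧ₙ q⁺ ℕ.* m)

√ℚ-nonneg : ∀ n q → 0ℚ ℚ.≤ √ℚ n q
√ℚ-nonneg n q = /-nonneg (isqrt (ℤ.∣ ↥ (q ℚ.⊔ 0ℚ) ∣ ℕ.* ↧ₙ (q ℚ.⊔ 0ℚ) ℕ.* (suc n ℕ.* suc n))) _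
  where
  /-nonneg : ∀ r d .{{_ : ℕ.NonZero d}} → 0ℚ ℚ.≤ + r ℚ./ d
  /-nonneg r d = ℚP.nonNegative⁻¹ (+ r ℚ./ d) {{ℚP.normalize-nonNeg r d}}

√ℚ-spec : ∀ n q → let s = √ℚ n q ; q⁺ = q ℚ.⊔ 0ℚ ; δ = + 1 ℚ./ suc n in
          s ℚ.* s ℚ.≤ q⁺ × q⁺ ℚ.< (s ℚ.+ δ) ℚ.* (s ℚ.+ δ)
√ℚ-spec n q = lower , upper
  where
  open ℚP.≤-Reasoning
  p = q ℚ.⊔ 0ℚ
  m = suc n
  a = ℤ.∣ ↥ p ∣
  d = ↧ₙ p
  b = d ℕ.* m
  N = a ℕ.* d ℕ.* (m ℕ.* m)
  r = isqrt N
  s = √ℚ n q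
  δ = + 1 ℚ./ m
  0≤p : 0ℚ ℚ.≤ p
  0≤p = ℚP.p≤q⊔p q 0ℚ
  p·d : p ℚ.* ℕ→ℚ d ≡ ℕ→ℚ a
  p·d = trans (cong (ℚ._* ℕ→ℚ d) (sym (ℚP.↥p/↧p≡p p)))
        (trans (/-cancel (↥ p) d) (cong (ℚ._/ 1) (sym (num p (ℚ.nonNegative 0≤p)))))
    where
    num : ∀ p → ℚ.NonNegative p → + ℤ.∣ ↥ p ∣ ≡ ↥ p
    num (ℚ.mkℚ (+ _) _ _) _ = refl
  s·b : s ℚ.* ℕ→ℚ b ≡ ℕ→ℚ r
  s·b = /-cancel (+ r) b
  δ·b : δ ℚ.* ℕ→ℚ b ≡ ℕ→ℚ d
  δ·b = begin-equality
    δ ℚ.* ℕ→ℚ b                  ≡⟨ cong (δ ℚ.*_) (ℕ→ℚ-* d m) ⟩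
    δ ℚ.* (ℕ→ℚ d ℚ.* ℕ→ℚ m)      ≡⟨ solve 3 (λ e d m → e :* (d :* m) := d :* (e :* m)) refl δ (ℕ→ℚ d) (ℕ→ℚ m) ⟩
    ℕ→ℚ d ℚ.* (δ ℚ.* ℕ→ℚ m)      ≡⟨ cong (ℕ→ℚ d ℚ.*_) (/-cancel (+ 1) m) ⟩
    ℕ→ℚ d ℚ.* 1ℚ                 ≡⟨ ℚP.*-identityʳ (ℕ→ℚ d) ⟩
    ℕ→ℚ d                        ∎
  B = ℕ→ℚ b ℚ.* ℕ→ℚ b
  0<b : 0ℚ ℚ.< ℕ→ℚ b
  0<b = ℕ→ℚ-mono-< {0} {b} (s≤s z≤n)
  0<B : 0ℚ ℚ.< B
  0<B = *-pos 0<b 0<b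
  p·B : p ℚ.* B ≡ ℕ→ℚ N
  p·B = begin-equality
    p ℚ.* B
      ≡⟨ cong (λ z → p ℚ.* (z ℚ.* z)) (ℕ→ℚ-* d m) ⟩
    p ℚ.* ((ℕ→ℚ d ℚ.* ℕ→ℚ m) ℚ.* (ℕ→ℚ d ℚ.* ℕ→ℚ m))
      ≡⟨ solve 3 (λ p d m → p :* ((d :* m) :* (d :* m)) := p :* d :* d :* (m :* m)) refl p (ℕ→ℚ d) (ℕ→ℚ m) ⟩
    p ℚ.* ℕ→ℚ d ℚ.* ℕ→ℚ d ℚ.* (ℕ→ℚ m ℚ.* ℕ→ℚ m)
      ≡⟨ cong₂ (λ u v → u ℚ.* ℕ→ℚ d ℚ.* v) p·d (sym (ℕ→ℚ-* m m)) ⟩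
    ℕ→ℚ a ℚ.* ℕ→ℚ d ℚ.* ℕ→ℚ (m ℕ.* m)
      ≡⟨ cong (ℚ._* ℕ→ℚ (m ℕ.* m)) (sym (ℕ→ℚ-* a d)) ⟩
    ℕ→ℚ (a ℕ.* d) ℚ.* ℕ→ℚ (m ℕ.* m)
      ≡⟨ sym (ℕ→ℚ-* (a ℕ.* d) (m ℕ.* m)) ⟩
    ℕ→ℚ N ∎
  sq·B : ∀ t → t ℚ.* t ℚ.* B ≡ (t ℚ.* ℕ→ℚ b) ℚ.* (t ℚ.* ℕ→ℚ b)
  sq·B t = solve 2 (λ t b → t :* t :* (b :* b) := (t :* b) :* (t :* b)) refl t (ℕ→ℚ b)
  lower : s ℚ.* s ℚ.≤ p
  lower = ℚP.*-cancelʳ-≤-pos B {{ℚ.positive 0<B}} (begin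
    s ℚ.* s ℚ.* B                          ≡⟨ sq·B s ⟩
    (s ℚ.* ℕ→ℚ b) ℚ.* (s ℚ.* ℕ→ℚ b)        ≡⟨ cong (λ z → z ℚ.* z) s·b ⟩
    ℕ→ℚ r ℚ.* ℕ→ℚ r                        ≡⟨ sym (ℕ→ℚ-* r r) ⟩
    ℕ→ℚ (r ℕ.* r)                          ≤⟨ ℕ→ℚ-mono-≤ (proj₁ (isqrt-spec N)) ⟩
    ℕ→ℚ N                                  ≡⟨ sym p·B ⟩
    p ℚ.* B                                ∎)
  t·b : (s ℚ.+ δ) ℚ.* ℕ→ℚ b ≡ ℕ→ℚ (r ℕ.+ d)
  t·b = trans (ℚP.*-distribʳ-+ (ℕ→ℚ b) s δ) (trans (cong₂ ℚ._+_ s·b δ·b) (sym (ℕ→ℚ-+ r d)))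
  1+r≤r+d : suc r ℕ.≤ r ℕ.+ d
  1+r≤r+d = subst (ℕ._≤ r ℕ.+ d) (ℕP.+-comm r 1) (ℕP.+-monoʳ-≤ r (s≤s z≤n))
  upper : p ℚ.< (s ℚ.+ δ) ℚ.* (s ℚ.+ δ)
  upper = ℚP.*-cancelʳ-<-nonNeg B {{ℚ.nonNegative (ℚP.<⇒≤ 0<B)}} (begin-strict
    p ℚ.* B                                          ≡⟨ p·B ⟩
    ℕ→ℚ N                                            <⟨ ℕ→ℚ-mono-< (proj₂ (isqrt-spec N)) ⟩
    ℕ→ℚ (suc r ℕ.* suc r)                            ≤⟨ ℕ→ℚ-mono-≤ (ℕP.*-mono-≤ 1+r≤r+d 1+r≤r+d) ⟩
    ℕ→ℚ ((r ℕ.+ d) ℕ.* (r ℕ.+ d))                    ≡⟨ ℕ→ℚ-* (r ℕ.+ d) (r ℕ.+ d) ⟩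
    ℕ→ℚ (r ℕ.+ d) ℚ.* ℕ→ℚ (r ℕ.+ d)                  ≡⟨ cong (λ z → z ℚ.* z) (sym t·b) ⟩
    ((s ℚ.+ δ) ℚ.* ℕ→ℚ b) ℚ.* ((s ℚ.+ δ) ℚ.* ℕ→ℚ b)  ≡⟨ sym (sq·B (s ℚ.+ δ)) ⟩
    (s ℚ.+ δ) ℚ.* (s ℚ.+ δ) ℚ.* B                    ∎)

√ℚ-close : ∀ {η} m n p q → 0ℚ ℚ.< η → + 1 ℚ./ suc n ℚ.< η → p ℚ.- q ℚ.< η ℚ.* η →
           √ℚ m p ℚ.- √ℚ n q ℚ.< η ℚ.+ η
√ℚ-close {η} m n p q 0<η δ<η p-q<η² = subst (s ℚ.- t ℚ.<_)
  (solve 2 (λ t e → t :+ e :+ e :- t := e :+ e) refl t η)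
  (ℚP.+-monoˡ-< (ℚ.- t) {s} {t ℚ.+ η ℚ.+ η} (sq-cancel-< {s} {t ℚ.+ η ℚ.+ η} (+-nonneg 0≤t+η (ℚP.<⇒≤ 0<η)) (begin-strict
    s ℚ.* s                                     ≤⟨ proj₁ (√ℚ-spec m p) ⟩
    p ℚ.⊔ 0ℚ                                    ≤⟨ ℚP.⊔-lub p≤ 0≤ ⟩
    q ℚ.⊔ 0ℚ ℚ.+ η ℚ.* η                        <⟨ ℚP.+-monoˡ-< (η ℚ.* η) (proj₂ (√ℚ-spec n q)) ⟩
    (t ℚ.+ δ) ℚ.* (t ℚ.+ δ) ℚ.+ η ℚ.* η         ≤⟨ ℚP.+-monoˡ-≤ (η ℚ.* η) (*-mono-≤ 0≤t+η 0≤t+δ t+δ≤t+η t+δ≤t+η) ⟩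
    (t ℚ.+ η) ℚ.* (t ℚ.+ η) ℚ.+ η ℚ.* η         ≡⟨ sym (ℚP.+-identityʳ _) ⟩
    (t ℚ.+ η) ℚ.* (t ℚ.+ η) ℚ.+ η ℚ.* η ℚ.+ 0ℚ  ≤⟨ ℚP.+-monoʳ-≤ ((t ℚ.+ η) ℚ.* (t ℚ.+ η) ℚ.+ η ℚ.* η) 0≤cross ⟩
    (t ℚ.+ η) ℚ.* (t ℚ.+ η) ℚ.+ η ℚ.* η ℚ.+ ((t ℚ.+ η) ℚ.* η ℚ.+ (t ℚ.+ η) ℚ.* η)
      ≡⟨ solve 2 (λ u e → u :* u :+ e :* e :+ (u :* e :+ u :* e) := (u :+ e) :* (u :+ e)) refl (t ℚ.+ η) η ⟩
    (t ℚ.+ η ℚ.+ η) ℚ.* (t ℚ.+ η ℚ.+ η)         ∎)))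
  where
  open ℚP.≤-Reasoning
  s = √ℚ m p
  t = √ℚ n q
  δ = + 1 ℚ./ suc n
  0≤t = √ℚ-nonneg n q
  0≤t+η = +-nonneg 0≤t (ℚP.<⇒≤ 0<η)
  0≤t+δ = +-nonneg 0≤t (ℚP.nonNegative⁻¹ δ {{ℚP.normalize-nonNeg 1 (suc n)}})
  t+δ≤t+η = ℚP.+-monoʳ-≤ t (ℚP.<⇒≤ δ<η)
  0≤[t+η]η : 0ℚ ℚ.≤ (t ℚ.+ η) ℚ.* η
  0≤[t+η]η = subst (ℚ._≤ (t ℚ.+ η) ℚ.* η) (ℚP.*-zeroˡ η)
    (ℚP.*-monoʳ-≤-nonNeg η {{ℚ.nonNegative (ℚP.<⇒≤ 0<η)}} 0≤t+η)
  0≤cross = +-nonneg 0≤[t+η]η 0≤[t+η]η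
  p≤ : p ℚ.≤ q ℚ.⊔ 0ℚ ℚ.+ η ℚ.* η
  p≤ = begin
    p                        ≡⟨ solve 2 (λ p q → p := q :+ (p :- q)) refl p q ⟩
    q ℚ.+ (p ℚ.- q)          ≤⟨ ℚP.+-mono-≤ (ℚP.p≤p⊔q q 0ℚ) (ℚP.<⇒≤ p-q<η²) ⟩
    q ℚ.⊔ 0ℚ ℚ.+ η ℚ.* η     ∎
  0≤ : 0ℚ ℚ.≤ q ℚ.⊔ 0ℚ ℚ.+ η ℚ.* η
  0≤ = +-nonneg (ℚP.p≤q⊔p q 0ℚ) (ℚP.<⇒≤ (*-pos 0<η 0<η))

-- √ x is the nonnegative square root of max(x, 0).
√_ : ℝ → ℝ
√ x = mkℝ (λ n → √ℚ n (seq x n)) λ ε 0<ε →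
  let η   = ε ℚ.* ½
      0<η = half-pos 0<ε
      M , hM = archimedean 0<η
      N , hN = cauchy x (η ℚ.* η) (*-pos 0<η 0<η)
      close = λ m n (m≥ : M ℕ.+ N ℕ.≤ m) (n≥ : M ℕ.+ N ℕ.≤ n) →
        subst (√ℚ m (seq x m) ℚ.- √ℚ n (seq x n) ℚ.<_) (half+half ε)
          (√ℚ-close m n (seq x m) (seq x n) 0<η (hM n (ℕP.m+n≤o⇒m≤o M n≥))
            (ℚP.≤-<-trans (p≤∣p∣ (seq x m ℚ.- seq x n))
              (hN m n (ℕP.m+n≤o⇒n≤o M m≥) (ℕP.m+n≤o⇒n≤o M n≥))))
  in M ℕ.+ N , λ m n m≥ n≥ → <⇒∣∣< (close m n m≥ n≥)
    (subst (ℚ._< ε) (solve 2 (λ a b → b :- a := :- (a :- b)) refl (√ℚ m (seq x m)) (√ℚ n (seq x n)))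
      (close n m n≥ m≥))

√-nonneg : ∀ x → fromℕ 0 ≤ √ x
√-nonneg x ε 0<ε = 0 , λ n _ → ℚP.+-mono-≤-< (√ℚ-nonneg n (seq x n)) 0<ε

√-square : ∀ x → fromℕ 0 ≤ x → √ x * √ x ≃ x
√-square x 0≤x ε 0<ε =
  let B , K , 0<B , hB = bounded (√ x)
      C   = B ℚ.+ B ℚ.+ 1ℚ
      0<C : 0ℚ ℚ.< C
      0<C = ℚP.+-mono-< (ℚP.+-mono-< 0<B 0<B) (ℚP.positive⁻¹ 1ℚ)
      instance
        posC = ℚ.positive 0<C
        nzC  = ℚP.pos⇒nonZero C
      η   = ε ℚ.* ℚ.1/ C
      0<η = *-pos 0<ε (ℚP.positive⁻¹ (ℚ.1/ C) {{ℚP.1/pos⇒pos C}})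
      L , hL = archimedean 0<η
      M , hM = 0≤x ε 0<ε
  in (K ℕ.+ L) ℕ.+ M , λ n n≥ →
    let n≥K+L = ℕP.m+n≤o⇒m≤o (K ℕ.+ L) n≥
        q = seq x n
        s = √ℚ n q
        δ = + 1 ℚ./ suc n
        0≤s = √ℚ-nonneg n q
        0≤δ = ℚP.nonNegative⁻¹ δ {{ℚP.normalize-nonNeg 1 (suc n)}}
        δ≤1 : δ ℚ.≤ 1ℚ
        δ≤1 = subst₂ ℚ._≤_ (ℚP.*-identityʳ δ) (/-cancel (+ 1) (suc n))
                (ℚP.*-monoˡ-≤-nonNeg δ {{ℚ.nonNegative 0≤δ}} (ℕ→ℚ-mono-≤ {1} {suc n} (s≤s z≤n)))
        s≤B = ℚP.≤-trans (p≤∣p∣ s) (hB n (ℕP.m+n≤o⇒m≤o K n≥K+L))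
        0<q+ε = subst (ℚ._< q ℚ.+ ε) refl (hM n (ℕP.m+n≤o⇒n≤o (K ℕ.+ L) n≥))
    in <⇒∣∣<
      (begin-strict
        s ℚ.* s ℚ.- q         ≤⟨ ℚP.+-monoˡ-≤ (ℚ.- q) (proj₁ (√ℚ-spec n q)) ⟩
        (q ℚ.⊔ 0ℚ) ℚ.- q      <⟨ ⊔-bound q 0<ε 0<q+ε ⟩
        ε                     ∎)
      (begin-strict
        ℚ.- (s ℚ.* s ℚ.- q)
          ≡⟨ solve 2 (λ s q → :- (s :* s :- q) := q :- s :* s) refl s q ⟩
        q ℚ.- s ℚ.* s
          ≤⟨ ℚP.+-monoˡ-≤ (ℚ.- (s ℚ.* s)) (ℚP.p≤p⊔q q 0ℚ) ⟩
        (q ℚ.⊔ 0ℚ) ℚ.- s ℚ.* s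
          <⟨ ℚP.+-monoˡ-< (ℚ.- (s ℚ.* s)) (proj₂ (√ℚ-spec n q)) ⟩
        (s ℚ.+ δ) ℚ.* (s ℚ.+ δ) ℚ.- s ℚ.* s
          ≡⟨ solve 2 (λ s d → (s :+ d) :* (s :+ d) :- s :* s := (s :+ s :+ d) :* d) refl s δ ⟩
        (s ℚ.+ s ℚ.+ δ) ℚ.* δ
          ≤⟨ ℚP.*-monoʳ-≤-nonNeg δ {{ℚ.nonNegative 0≤δ}} (ℚP.+-mono-≤ (ℚP.+-mono-≤ s≤B s≤B) δ≤1) ⟩
        C ℚ.* δ
          <⟨ ℚP.*-monoʳ-<-pos C (hL n (ℕP.m+n≤o⇒n≤o K n≥K+L)) ⟩
        C ℚ.* η
          ≡⟨ solve 3 (λ c e i → c :* (e :* i) := e :* (c :* i)) refl C ε (ℚ.1/ C) ⟩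
        ε ℚ.* (C ℚ.* ℚ.1/ C)
          ≡⟨ cong (ε ℚ.*_) (ℚP.*-inverseʳ C) ⟩
        ε ℚ.* 1ℚ
          ≡⟨ ℚP.*-identityʳ ε ⟩
        ε ∎)
  where
  open ℚP.≤-Reasoning
  ⊔-bound : ∀ q → 0ℚ ℚ.< ε → 0ℚ ℚ.< q ℚ.+ ε → (q ℚ.⊔ 0ℚ) ℚ.- q ℚ.< ε
  ⊔-bound q 0<ε 0<q+ε with ℚP.≤-total q 0ℚ
  ... | inj₁ q≤0 = subst₂ ℚ._<_ (cong (ℚ._- q) (sym (ℚP.p≤q⇒p⊔q≡q q≤0)))
    (solve 2 (λ q e → q :+ e :- q := e) refl q ε) (ℚP.+-monoˡ-< (ℚ.- q) 0<q+ε)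
  ... | inj₂ 0≤q = subst (ℚ._< ε)
    (sym (trans (cong (ℚ._- q) (ℚP.p≥q⇒p⊔q≡p 0≤q)) (ℚP.+-inverseʳ q))) 0<ε

infixl 7 _/2

_/2 : ℝ → ℝ
x /2 = x * fromℚ ½

+-rawMonoid : RawMonoid 0ℓ 0ℓ
+-rawMonoid = record { Carrier = ℝ ; _≈_ = _≃_ ; _∙_ = _+_ ; ε = fromℕ 0 }

open import Algebra.Definitions.RawMonoid +-rawMonoid public using (sum)

⟨_,_⟩ : ∀ {n} → (Fin n → ℝ) → (Fin n → ℝ) → ℝ
⟨ f , g ⟩ = sum (λ x → f x * g x)

𝟙 : ∀ {n} → Fin n → ℝ
𝟙 _ = fromℕ 1

_·_ : ∀ {m n} → (Fin m → Fin n → ℝ) → (Fin n → ℝ) → Fin m → ℝ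
(M · f) x = ⟨ M x , f ⟩

IsMaximum : {A : Set} → (A → Set) → (A → ℝ) → ℝ → Set
IsMaximum P φ m = (∃ λ a → P a × φ a ≃ m) × (∀ a → P a → φ a ≤ m)

record Graph : Set₁ where
  field
    order      : ℕ
    Adj        : Rel (Fin order) 0ℓ
    adj?       : Decidable Adj
    adj-sym    : Symmetric Adj
    adj-irrefl : Irreflexive _≡_ Adj

  V : Set
  V = Fin order

module _ (G : Graph) where
  open Graph G using (V; order; Adj; adj?)

  neighbours : V → Subset order
  neighbours x = tabulate (λ y → does (adj? x y))

  -- For a complete graph `nonadjacent` is vacuous, so μ is then unconstrained.
  record IsSRG (n k ℓ μ : ℕ) : Set where
    field
      vertices    : order ≡ n
      regular     : ∀ x → ∣ neighbours x ∣ ≡ k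
      adjacent    : ∀ x y → Adj x y → ∣ neighbours x ∩ neighbours y ∣ ≡ ℓ
      nonadjacent : ∀ x y → x ≢ y → ¬ Adj x y → ∣ neighbours x ∩ neighbours y ∣ ≡ μ

  NonComplete : Set
  NonComplete = ∃₂ λ x y → x ≢ y × ¬ Adj x y

  data Walk : V → V → ℕ → Set where
    nil  : ∀ {x} → Walk x x 0
    cons : ∀ {x y z l} → Adj x y → Walk y z l → Walk x z (suc l)

  Connected : Set
  Connected = ∀ x y → ∃ λ l → Walk x y l

  walk? : ∀ x y l → Dec (Walk x y l)
  walk? x y zero    = map′ (λ { refl → nil }) (λ { nil → refl }) (x ≟ᶠ y)
  walk? x y (suc l) = map′ (λ { (z , a , w) → cons a w }) (λ { (cons a w) → _ , a , w })
                           (any? λ z → adj? x z ×-dec walk? z y l)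

least : ∀ {P : ℕ → Set} → U.Decidable P → ∃ P → ∃ λ m → P m × (∀ j → P j → m ℕ.≤ j)
least {P} P? (n , Pn) = go P? n Pn
  where
  go : ∀ {P : ℕ → Set} → U.Decidable P → ∀ n → P n → ∃ λ m → P m × (∀ j → P j → m ℕ.≤ j)
  go P? zero    P0 = 0 , P0 , λ _ _ → z≤n
  go P? (suc n) Pn with P? 0
  ... | yes P0 = 0 , P0 , λ _ _ → z≤n
  ... | no ¬P0 =
    let m , Pm , min = go (P? ∘ suc) n Pn
    in suc m , Pm , λ { zero P0 → contradiction P0 ¬P0 ; (suc j) Pj → s≤s (min j Pj) }

module _ (G : Graph) (conn : Connected G) where
  open Graph G using (V)

  -- A shortest walk is a path, so this is the usual graph distance.
  dist : V → V → ℕ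
  dist x y = proj₁ (least (walk? G x y) (conn x y))

  distanceMatrix : V → V → ℝ
  distanceMatrix x y = fromℕ (dist x y)

  -- IsQEC c reads QEC(G) = c.
  IsQEC : ℝ → Set
  IsQEC = IsMaximum (λ (f : V → ℝ) → ⟨ f , f ⟩ ≃ fromℕ 1 × ⟨ 𝟙 , f ⟩ ≃ fromℕ 0)
                    (λ f → ⟨ f , distanceMatrix · f ⟩)

∈-neighbours⁻ : ∀ G {x y} → y ∈ neighbours G x → Graph.Adj G x y
∈-neighbours⁻ G {x} {y} y∈ with Graph.adj? G x y | trans (sym (lookup∘tabulate (λ z → does (Graph.adj? G x z)) y)) ([]=⇒lookup y∈)
... | yes a | _ = a

srg-connected : ∀ {G n k ℓ μ} → IsSRG G n k ℓ μ → 1 ℕ.≤ μ → Connected G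
srg-connected {G} srg 1≤μ x y with x ≟ᶠ y
... | yes refl = 0 , nil
... | no x≢y with Graph.adj? G x y
...   | yes a = 1 , cons a nil
...   | no ¬a with nonempty? (neighbours G x ∩ neighbours G y)
...     | yes (z , z∈) =
  let z∈x , z∈y = x∈p∩q⁻ (neighbours G x) (neighbours G y) z∈
  in 2 , cons (∈-neighbours⁻ G z∈x) (cons (Graph.adj-sym G (∈-neighbours⁻ G z∈y)) nil)
...     | no empty = contradiction
  (subst (1 ℕ.≤_) (trans (sym (IsSRG.nonadjacent srg x y x≢y ¬a))
    (trans (cong ∣_∣ (Empty-unique empty)) (∣⊥∣≡0 (Graph.order G)))) 1≤μ) λ ()

{-# OPTIONS --safe #-}
module Submission where

-- On 𝟙^⊥ the distance matrix 2J − 2I − A acts as −2 − A, and A² = kI + ℓA + μ(J − I − A) acts as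
-- bA + m with b = ℓ − μ, m = k − μ. Let s = √(b² + 4m), and let τ, θ = (b ∓ s)/2 be the roots of
-- X² = bX + m. Then ‖Af − τf‖² = s(⟨f, Af⟩ − τ‖f‖²), which bounds ⟨f, Af⟩ below by τ‖f‖² since s > 0.
-- Equality holds for f = Ag − θg with g = eₓ − e_z, x adjacent to z: here Af = τf and
-- ‖f‖² = s(s + b + 2), which is invertible because s² − (b + 2)² = 4(k − ℓ − 1) > 0.

open import Algebra.Bundles using (CommutativeRing; RawRing)
import Algebra.Properties.Semiring.Sum
import Algebra.Solver.Ring
open import Algebra.Solver.Ring.AlmostCommutativeRing using (fromCommutativeRing; _-Raw-AlmostCommutative⟶_)
open import Data.Bool.Base using (Bool; true; false; if_then_else_; _∧_)
open import Data.Fin.Base using (Fin; zero; suc)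
open import Data.Fin.Properties using () renaming (_≟_ to _≟ᶠ_)
open import Data.Fin.Subset using (Subset; ∣_∣; _∩_; _∈_; _⊆_) renaming (_-_ to _∖_)
open import Data.Fin.Subset.Properties
  using (nonempty?; Empty-unique; ∣⊥∣≡0; x∈p∩q⁻; x∈p∧x≢y⇒x∈p-y; x∈p⇒∣p-x∣<∣p∣; p⊆q⇒∣p∣≤∣q∣; ∩-idem)
open import Data.Integer.Base using (+_)
open import Data.Maybe.Base using (map)
open import Data.Nat.Base as ℕ using (ℕ; zero; suc; z≤n; s≤s)
import Data.Nat.Properties as ℕP
open import Data.Product.Base using (_×_; _,_; ∃; proj₁; proj₂)
open import Data.Rational.Base as ℚ using (ℚ; 0ℚ; 1ℚ; ½)
import Data.Rational.Properties as ℚP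
open import Data.Rational.Solver using (module +-*-Solver)
open import Data.Sum.Base using (inj₁; inj₂)
open import Data.Vec.Base using ([]; _∷_; lookup; tabulate)
open import Data.Vec.Properties using (lookup∘tabulate; lookup-zipWith; lookup⇒[]=)
open import Level using (0ℓ)
open import Relation.Binary.Consequences using (dec⇒weaklyDec)
open import Relation.Binary.PropositionalEquality as ≡ using (_≡_; _≢_; refl; cong; subst; subst₂)
open import Relation.Nullary.Decidable using (does; yes; no; dec-true; dec-false)
open import Relation.Nullary.Negation using (¬_; contradiction)

open import Defs using (ℕ→ℚ; ℕ→ℚ-+)

-- Both halves of the maximum reduce to exact identities: the gap between the constant and ⟨f, Df⟩
-- is a multiple of a squared norm, and the maximiser is explicit. The identities are proved in a
-- commutative ring; order is used only over ℝ. The obstacle is division, since a Cauchy real can be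
-- inverted only with evidence that it stays away from 0. But b and m are integers, so s² is
-- rational and only rationals are ever inverted: 1/s is written t s with t = 1/s², and the squared
-- norm of the maximiser is inverted by rationalising it in the same way. The origin of g: A - θI
-- kills the θ-eigenvectors, so it sends 𝟙^⊥ into the τ-eigenspace, and what remains is to start
-- from a vector that it does not kill. For an edge, ⟨g, Ag⟩ = -2 and ‖g‖² = 2, so the image has
-- squared norm 2s(θ + 1), and it survives because θ > -1. A non-adjacent pair together with μ ≥ 1
-- provides a common neighbour, which gives both the edge and the inequality k ≥ ℓ + 2 behind θ >
-- -1.

ℚ-rawRing : RawRing 0ℓ 0ℓ
ℚ-rawRing = CommutativeRing.rawRing ℚP.+-*-commutativeRing

-- Linear algebra over a commutative ℚ-algebra

-- The algebra is kept abstract because computing in ℝ directly makes Agda compare Cauchy proofs.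
module RationalAlgebra (R : CommutativeRing 0ℓ 0ℓ)
                       (φ : ℚ-rawRing -Raw-AlmostCommutative⟶ fromCommutativeRing R) where
  open CommutativeRing R hiding (zero) renaming (refl to ≈-refl; sym to ≈-sym; trans to ≈-trans; reflexive to ≈-reflexive)
  open Algebra.Properties.Semiring.Sum semiring
  open import Relation.Binary.Reasoning.Setoid setoid
  open _-Raw-AlmostCommutative⟶_ φ using (⟦_⟧; 0-homo; 1-homo; +-homo)

  open Algebra.Solver.Ring ℚ-rawRing (fromCommutativeRing R) φ
    (λ p q → map (λ p≡q → ≈-reflexive (cong ⟦_⟧ p≡q)) (dec⇒weaklyDec ℚP._≟_ p q))
    using (solve; _:+_; _:*_; :-_; _:-_; _:=_; con)

  Vector : ℕ → Set
  Vector n = Fin n → Carrier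

  Matrix : ℕ → Set
  Matrix n = Fin n → Vector n

  infix 4 _≋_
  _≋_ : ∀ {n} → Vector n → Vector n → Set
  f ≋ g = ∀ x → f x ≈ g x

  1ᵥ : ∀ {n} → Vector n
  1ᵥ _ = 1#

  indicator : Bool → Carrier
  indicator b = if b then 1# else 0#

  I : ∀ {n} → Matrix n
  I x y = indicator (does (x ≟ᶠ y))

  infix 5 ⟨_,_⟩
  ⟨_,_⟩ : ∀ {n} → Vector n → Vector n → Carrier
  ⟨ f , g ⟩ = sum (λ x → f x * g x)

  infixr 6 _·_
  _·_ : ∀ {n} → Matrix n → Vector n → Vector n
  (M · f) x = ⟨ M x , f ⟩

  comb : ∀ {n} → Carrier → Vector n → Carrier → Vector n → Vector n
  comb a f b g x = a * f x + b * g x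

  ⟨⟩-cong : ∀ {n} {f f′ g g′ : Vector n} → f ≋ f′ → g ≋ g′ → ⟨ f , g ⟩ ≈ ⟨ f′ , g′ ⟩
  ⟨⟩-cong f≋ g≋ = sum-cong-≋ λ x → *-cong (f≋ x) (g≋ x)

  ⟨⟩-congʳ : ∀ {n} (f : Vector n) {g g′ : Vector n} → g ≋ g′ → ⟨ f , g ⟩ ≈ ⟨ f , g′ ⟩
  ⟨⟩-congʳ f = ⟨⟩-cong {f = f} λ _ → ≈-refl

  ⟨⟩-comm : ∀ {n} (f g : Vector n) → ⟨ f , g ⟩ ≈ ⟨ g , f ⟩
  ⟨⟩-comm f g = sum-cong-≋ λ x → *-comm (f x) (g x)

  ⟨⟩-scaleʳ : ∀ {n} a (f g : Vector n) → ⟨ f , (λ x → a * g x) ⟩ ≈ a * ⟨ f , g ⟩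
  ⟨⟩-scaleʳ a f g = begin
    ⟨ f , (λ x → a * g x) ⟩        ≈⟨ sum-cong-≋ (λ x → solve 3 (λ a f g → f :* (a :* g) := a :* (f :* g)) ≈-refl a (f x) (g x)) ⟩
    sum (λ x → a * (f x * g x))    ≈⟨ *-distribˡ-sum a (λ x → f x * g x) ⟨
    a * ⟨ f , g ⟩                  ∎

  ⟨⟩-combʳ : ∀ {n} (f : Vector n) a g b h → ⟨ f , comb a g b h ⟩ ≈ a * ⟨ f , g ⟩ + b * ⟨ f , h ⟩
  ⟨⟩-combʳ f a g b h = begin
    ⟨ f , comb a g b h ⟩
      ≈⟨ sum-cong-≋ (λ x → distribˡ (f x) (a * g x) (b * h x)) ⟩
    sum (λ x → f x * (a * g x) + f x * (b * h x))
      ≈⟨ ∑-distrib-+ (λ x → f x * (a * g x)) (λ x → f x * (b * h x)) ⟩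
    ⟨ f , (λ x → a * g x) ⟩ + ⟨ f , (λ x → b * h x) ⟩
      ≈⟨ +-cong (⟨⟩-scaleʳ a f g) (⟨⟩-scaleʳ b f h) ⟩
    a * ⟨ f , g ⟩ + b * ⟨ f , h ⟩ ∎

  ⟨⟩-combˡ : ∀ {n} (f : Vector n) a g b h → ⟨ comb a g b h , f ⟩ ≈ a * ⟨ g , f ⟩ + b * ⟨ h , f ⟩
  ⟨⟩-combˡ f a g b h = begin
    ⟨ comb a g b h , f ⟩            ≈⟨ ⟨⟩-comm (comb a g b h) f ⟩
    ⟨ f , comb a g b h ⟩            ≈⟨ ⟨⟩-combʳ f a g b h ⟩
    a * ⟨ f , g ⟩ + b * ⟨ f , h ⟩   ≈⟨ +-cong (*-congˡ (⟨⟩-comm f g)) (*-congˡ (⟨⟩-comm f h)) ⟩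
    a * ⟨ g , f ⟩ + b * ⟨ h , f ⟩   ∎

  ⟨⟩-assoc : ∀ {n} (f : Vector n) (M : Matrix n) g →
             ⟨ f , M · g ⟩ ≈ ⟨ (λ y → sum (λ x → f x * M x y)) , g ⟩
  ⟨⟩-assoc {n} f M g = begin
    ⟨ f , M · g ⟩
      ≈⟨ sum-cong-≋ (λ x → *-distribˡ-sum (f x) (λ y → M x y * g y)) ⟩
    sum (λ x → sum (λ y → f x * (M x y * g y)))
      ≈⟨ ∑-comm (λ x y → f x * (M x y * g y)) ⟩
    sum (λ y → sum (λ x → f x * (M x y * g y)))
      ≈⟨ sum-cong-≋ (λ y → sum-cong-≋ (λ x → *-assoc (f x) (M x y) (g y))) ⟨
    sum (λ y → sum (λ x → f x * M x y * g y))
      ≈⟨ sum-cong-≋ (λ y → *-distribʳ-sum (g y) (λ x → f x * M x y)) ⟨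
    ⟨ (λ y → sum (λ x → f x * M x y)) , g ⟩ ∎

  ⟨1ᵥ,_⟩ : ∀ {n} (f : Vector n) → ⟨ 1ᵥ , f ⟩ ≈ sum f
  ⟨1ᵥ, f ⟩ = sum-cong-≋ λ x → *-identityˡ (f x)

  ⟨I,_⟩ : ∀ {n} (f : Vector n) x → ⟨ I x , f ⟩ ≈ f x
  ⟨I,_⟩ {suc n} f zero = begin
    1# * f zero + ⟨ (λ _ → 0#) , (λ y → f (suc y)) ⟩
      ≈⟨ +-cong (*-identityˡ (f zero)) (≈-sym (*-distribˡ-sum 0# (λ y → f (suc y)))) ⟩
    f zero + 0# * sum (λ y → f (suc y))   ≈⟨ +-congˡ (zeroˡ _) ⟩
    f zero + 0#                           ≈⟨ +-identityʳ _ ⟩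
    f zero                                ∎
  -- Past its first entry, row `suc x` of `I` computes to row `x` of the smaller identity matrix.
  ⟨I,_⟩ {suc n} f (suc x) = begin
    0# * f zero + ⟨ I x , (λ y → f (suc y)) ⟩   ≈⟨ +-cong (zeroˡ _) (⟨I,_⟩ (λ y → f (suc y)) x) ⟩
    0# + f (suc x)                              ≈⟨ +-identityˡ _ ⟩
    f (suc x)                                   ∎

  I-diagonal : ∀ {n} (x : Fin n) → I x x ≈ 1#
  I-diagonal x = ≈-reflexive (cong indicator (dec-true (x ≟ᶠ x) refl))

  I-offDiagonal : ∀ {n} {x y : Fin n} → x ≢ y → I x y ≈ 0#
  I-offDiagonal {x = x} {y} x≢y = ≈-reflexive (cong indicator (dec-false (x ≟ᶠ y) x≢y))

  sum-indicator : ∀ {n} (p : Subset n) → sum (λ x → indicator (lookup p x)) ≈ ⟦ ℕ→ℚ ∣ p ∣ ⟧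
  sum-indicator []          = ≈-sym 0-homo
  sum-indicator (true ∷ p)  = begin
    1# + sum (λ x → indicator (lookup p x))   ≈⟨ +-cong (≈-sym 1-homo) (sum-indicator p) ⟩
    ⟦ 1ℚ ⟧ + ⟦ ℕ→ℚ ∣ p ∣ ⟧                    ≈⟨ +-homo 1ℚ (ℕ→ℚ ∣ p ∣) ⟨
    ⟦ 1ℚ ℚ.+ ℕ→ℚ ∣ p ∣ ⟧                      ≡⟨ cong ⟦_⟧ (ℕ→ℚ-+ 1 ∣ p ∣) ⟨
    ⟦ ℕ→ℚ (suc ∣ p ∣) ⟧                       ∎
  sum-indicator (false ∷ p) = ≈-trans (+-identityˡ _) (sum-indicator p)

  indicator-∧ : ∀ a b → indicator a * indicator b ≈ indicator (a ∧ b)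
  indicator-∧ true  b = *-identityˡ _
  indicator-∧ false b = zeroˡ _

  -- Zero-one matrices

  booleanMatrix : ∀ {n} → (Fin n → Fin n → Bool) → Matrix n
  booleanMatrix a x y = indicator (a x y)

  module _ {n} (a : Fin n → Fin n → Bool) where

    booleanMatrix-sym : (∀ x y → a x y ≡ a y x) → ∀ x y → booleanMatrix a x y ≈ booleanMatrix a y x
    booleanMatrix-sym a-sym x y = ≈-reflexive (cong indicator (a-sym x y))

    booleanMatrix-1ᵥ : ∀ x {d} → ∣ tabulate (a x) ∣ ≡ d → ⟨ booleanMatrix a x , 1ᵥ ⟩ ≈ ⟦ ℕ→ℚ d ⟧
    booleanMatrix-1ᵥ x refl = ≈-trans
      (sum-cong-≋ λ y → ≈-trans (*-identityʳ _)
        (≈-reflexive (cong indicator (≡.sym (lookup∘tabulate (a x) y)))))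
      (sum-indicator (tabulate (a x)))

    -- Symmetry turns column `y` into row `y`, and a product of indicators is the indicator of an
    -- intersection, so an entry of the square counts common neighbours.
    booleanMatrix-square : (∀ x y → a x y ≡ a y x) → ∀ x y {d} → ∣ tabulate (a x) ∩ tabulate (a y) ∣ ≡ d →
      sum (λ z → booleanMatrix a x z * booleanMatrix a z y) ≈ ⟦ ℕ→ℚ d ⟧
    booleanMatrix-square a-sym x y refl = ≈-trans (sum-cong-≋ term) (sum-indicator (tabulate (a x) ∩ tabulate (a y)))
      where
      term : ∀ z → indicator (a x z) * indicator (a z y) ≈ indicator (lookup (tabulate (a x) ∩ tabulate (a y)) z)
      term z = begin
        indicator (a x z) * indicator (a z y)
          ≡⟨ cong (λ b → indicator (a x z) * indicator b) (a-sym z y) ⟩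
        indicator (a x z) * indicator (a y z)
          ≈⟨ indicator-∧ (a x z) (a y z) ⟩
        indicator (a x z ∧ a y z)
          ≡⟨ cong indicator (≡.cong₂ _∧_ (lookup∘tabulate (a x) z) (lookup∘tabulate (a y) z)) ⟨
        indicator (lookup (tabulate (a x)) z ∧ lookup (tabulate (a y)) z)
          ≡⟨ cong indicator (lookup-zipWith _∧_ z (tabulate (a x)) (tabulate (a y))) ⟨
        indicator (lookup (tabulate (a x) ∩ tabulate (a y)) z) ∎

  -- The constant `c` stands for c times the all-ones matrix, which annihilates 𝟙^⊥. Both A² and the
  -- distance matrix are of this form.
  span-action : ∀ {n} (A M : Matrix n) a b c → (∀ x y → M x y ≈ a * A x y + b * I x y + c) →
                ∀ f → ⟨ 1ᵥ , f ⟩ ≈ 0# → M · f ≋ comb a (A · f) b f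
  span-action A M a b c M≈ f f⊥1 x = begin
    ⟨ M x , f ⟩
      -- The factors `1#` bring the row into the shape of nested `comb`s, with `c` as a multiple of
      -- `1ᵥ`.
      ≈⟨ ⟨⟩-cong {g = f} (λ y → ≈-trans (M≈ x y)
           (+-cong (≈-sym (*-identityˡ _)) (≈-sym (*-identityʳ c)))) (λ _ → ≈-refl) ⟩
    ⟨ comb 1# (comb a (A x) b (I x)) c 1ᵥ , f ⟩
      ≈⟨ ⟨⟩-combˡ f 1# (comb a (A x) b (I x)) c 1ᵥ ⟩
    1# * ⟨ comb a (A x) b (I x) , f ⟩ + c * ⟨ 1ᵥ , f ⟩
      ≈⟨ +-cong (*-identityˡ _) (*-congˡ f⊥1) ⟩
    ⟨ comb a (A x) b (I x) , f ⟩ + c * 0#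
      ≈⟨ ≈-trans (+-congˡ (zeroʳ c)) (+-identityʳ _) ⟩
    ⟨ comb a (A x) b (I x) , f ⟩
      ≈⟨ ⟨⟩-combˡ f a (A x) b (I x) ⟩
    a * ⟨ A x , f ⟩ + b * ⟨ I x , f ⟩
      ≈⟨ +-congˡ (*-congˡ (⟨I, f ⟩ x)) ⟩
    comb a (A · f) b f x ∎

  -- Symmetric matrices and quadratic relations

  module _ {n} (A : Matrix n) (A-sym : ∀ x y → A x y ≈ A y x) where

    adjoint : ∀ f g → ⟨ f , A · g ⟩ ≈ ⟨ A · f , g ⟩
    adjoint f g = ≈-trans (⟨⟩-assoc f A g) (⟨⟩-cong {g = g}
      (λ y → sum-cong-≋ λ x → ≈-trans (*-comm (f x) (A x y)) (*-congʳ (A-sym x y))) (λ _ → ≈-refl))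

    -- This is (A - ρI)f. With one root of the quadratic it measures how far f is from being an
    -- eigenvector for that root; with the other it produces such an eigenvector.
    shift : Carrier → Vector n → Vector n
    shift ρ f = comb 1# (A · f) (- ρ) f

    -- Constant row sums make `1ᵥ` an eigenvector of the symmetric A, so A preserves its orthogonal
    -- complement. This keeps the maximiser admissible.
    shift-⊥1 : ∀ k → (∀ x → ⟨ A x , 1ᵥ ⟩ ≈ k) → ∀ ρ f → ⟨ 1ᵥ , f ⟩ ≈ 0# → ⟨ 1ᵥ , shift ρ f ⟩ ≈ 0#
    shift-⊥1 k A1≈k ρ f f⊥1 = begin
      ⟨ 1ᵥ , shift ρ f ⟩                           ≈⟨ ⟨⟩-combʳ 1ᵥ 1# (A · f) (- ρ) f ⟩
      1# * ⟨ 1ᵥ , A · f ⟩ + (- ρ) * ⟨ 1ᵥ , f ⟩     ≈⟨ +-cong (*-identityˡ _) (*-congˡ f⊥1) ⟩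
      ⟨ 1ᵥ , A · f ⟩ + (- ρ) * 0#                  ≈⟨ ≈-trans (+-congˡ (zeroʳ _)) (+-identityʳ _) ⟩
      ⟨ 1ᵥ , A · f ⟩                               ≈⟨ adjoint 1ᵥ f ⟩
      ⟨ A · 1ᵥ , f ⟩                               ≈⟨ ⟨⟩-cong {g = f} (λ x → ≈-trans (A1≈k x) (≈-sym (*-identityʳ k))) (λ _ → ≈-refl) ⟩
      ⟨ (λ x → k * 1ᵥ x) , f ⟩                     ≈⟨ ⟨⟩-comm (λ x → k * 1ᵥ x) f ⟩
      ⟨ f , (λ x → k * 1ᵥ x) ⟩                     ≈⟨ ⟨⟩-scaleʳ k f 1ᵥ ⟩
      k * ⟨ f , 1ᵥ ⟩                               ≈⟨ *-congˡ (≈-trans (⟨⟩-comm f 1ᵥ) f⊥1) ⟩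
      k * 0#                                       ≈⟨ zeroʳ k ⟩
      0#                                           ∎

    module _ (ρ σ : Carrier) (f : Vector n)
             (A²f : A · (A · f) ≋ comb (ρ + σ) (A · f) (- (ρ * σ)) f) where

      -- The hypothesis `A²f` says (A - ρI)(A - σI)f = 0. It is imposed on the single vector f
      -- because it will be available only on 𝟙^⊥.
      shift-eigen : A · shift σ f ≋ λ x → ρ * shift σ f x
      shift-eigen x = begin
        ⟨ A x , shift σ f ⟩
          ≈⟨ ⟨⟩-combʳ (A x) 1# (A · f) (- σ) f ⟩
        1# * (A · A · f) x + (- σ) * (A · f) x
          ≈⟨ +-congʳ (≈-trans (*-identityˡ _) (A²f x)) ⟩
        ((ρ + σ) * (A · f) x + - (ρ * σ) * f x) + (- σ) * (A · f) x
          ≈⟨ solve 4 (λ ρ σ u v → ((ρ :+ σ) :* u :+ (:- (ρ :* σ)) :* v) :+ (:- σ) :* u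
               := ρ :* (u :+ (:- σ) :* v)) ≈-refl ρ σ ((A · f) x) (f x) ⟩
        ρ * ((A · f) x + (- σ) * f x)
          ≈⟨ *-congˡ (+-congʳ (*-identityˡ _)) ⟨
        ρ * shift σ f x ∎

      -- By symmetry ‖Af‖² = ⟨f, A²f⟩, which the quadratic relation makes linear in P = ⟨f, Af⟩ and
      -- Q = ‖f‖²; the expanded square then has the factor σ - ρ. With ρ = τ this gives the upper
      -- bound, with ρ = θ the norm of the maximiser.
      norm-shift : ⟨ shift ρ f , shift ρ f ⟩ ≈ (σ - ρ) * (⟨ f , A · f ⟩ - ρ * ⟨ f , f ⟩)
      norm-shift = begin
        ⟨ h , h ⟩
          ≈⟨ ⟨⟩-combʳ h 1# (A · f) (- ρ) f ⟩
        1# * ⟨ h , A · f ⟩ + (- ρ) * ⟨ h , f ⟩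
          ≈⟨ +-cong (*-identityˡ _) (*-congˡ ⟨h,f⟩) ⟩
        ⟨ h , A · f ⟩ + (- ρ) * (P + (- ρ) * Q)
          ≈⟨ +-congʳ ⟨h,Af⟩ ⟩
        ((ρ + σ) * P + - (ρ * σ) * Q + (- ρ) * P) + (- ρ) * (P + (- ρ) * Q)
          ≈⟨ solve 4 (λ ρ σ P Q →
               ((ρ :+ σ) :* P :+ (:- (ρ :* σ)) :* Q :+ (:- ρ) :* P) :+ (:- ρ) :* (P :+ (:- ρ) :* Q)
               := (σ :- ρ) :* (P :- ρ :* Q)) ≈-refl ρ σ P Q ⟩
        (σ - ρ) * (P - ρ * Q) ∎
        where
        h = shift ρ f
        P = ⟨ f , A · f ⟩
        Q = ⟨ f , f ⟩
        ⟨h,f⟩ : ⟨ h , f ⟩ ≈ P + (- ρ) * Q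
        ⟨h,f⟩ = ≈-trans (⟨⟩-combˡ f 1# (A · f) (- ρ) f)
          (+-congʳ (≈-trans (*-identityˡ _) (⟨⟩-comm (A · f) f)))
        ⟨h,Af⟩ : ⟨ h , A · f ⟩ ≈ (ρ + σ) * P + - (ρ * σ) * Q + (- ρ) * P
        ⟨h,Af⟩ = begin
          ⟨ h , A · f ⟩
            ≈⟨ ⟨⟩-combˡ (A · f) 1# (A · f) (- ρ) f ⟩
          1# * ⟨ A · f , A · f ⟩ + (- ρ) * P
            ≈⟨ +-congʳ (≈-trans (*-identityˡ _) (≈-sym (adjoint f (A · f)))) ⟩
          ⟨ f , A · A · f ⟩ + (- ρ) * P
            ≈⟨ +-congʳ (≈-trans (⟨⟩-congʳ f A²f) (⟨⟩-combʳ f (ρ + σ) (A · f) (- (ρ * σ)) f)) ⟩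
          (ρ + σ) * P + - (ρ * σ) * Q + (- ρ) * P ∎

    -- The difference vector of an edge

    module Edge (x z : Fin n) (x≢z : x ≢ z)
                (Axx≈0 : A x x ≈ 0#) (Azz≈0 : A z z ≈ 0#) (Axz≈1 : A x z ≈ 1#) where

      -- The coefficients are images of rationals, the only constants that the ring solver
      -- evaluates.
      edgeVector : Vector n
      edgeVector = comb ⟦ 1ℚ ⟧ (I x) ⟦ ℚ.- 1ℚ ⟧ (I z)

      ⟨edgeVector,_⟩ : ∀ f → ⟨ edgeVector , f ⟩ ≈ f x - f z
      ⟨edgeVector, f ⟩ = begin
        ⟨ edgeVector , f ⟩
          ≈⟨ ⟨⟩-combˡ f ⟦ 1ℚ ⟧ (I x) ⟦ ℚ.- 1ℚ ⟧ (I z) ⟩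
        ⟦ 1ℚ ⟧ * ⟨ I x , f ⟩ + ⟦ ℚ.- 1ℚ ⟧ * ⟨ I z , f ⟩
          ≈⟨ +-cong (*-congˡ (⟨I, f ⟩ x)) (*-congˡ (⟨I, f ⟩ z)) ⟩
        ⟦ 1ℚ ⟧ * f x + ⟦ ℚ.- 1ℚ ⟧ * f z
          ≈⟨ solve 2 (λ u v → con 1ℚ :* u :+ con (ℚ.- 1ℚ) :* v := u :- v) ≈-refl (f x) (f z) ⟩
        f x - f z ∎

      edgeVector-⊥1 : ⟨ 1ᵥ , edgeVector ⟩ ≈ 0#
      edgeVector-⊥1 = ≈-trans (⟨⟩-comm 1ᵥ edgeVector) (≈-trans ⟨edgeVector, 1ᵥ ⟩ (-‿inverseʳ 1#))

      ⟨edgeVector,edgeVector⟩ : ⟨ edgeVector , edgeVector ⟩ ≈ ⟦ ℕ→ℚ 2 ⟧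
      ⟨edgeVector,edgeVector⟩ = begin
        ⟨ edgeVector , edgeVector ⟩
          ≈⟨ ⟨edgeVector, edgeVector ⟩ ⟩
        (⟦ 1ℚ ⟧ * I x x + ⟦ ℚ.- 1ℚ ⟧ * I z x) - (⟦ 1ℚ ⟧ * I x z + ⟦ ℚ.- 1ℚ ⟧ * I z z)
          ≈⟨ +-cong (+-cong (*-congˡ Ixx≈1) (*-congˡ Izx≈0)) (-‿cong (+-cong (*-congˡ Ixz≈0) (*-congˡ Izz≈1))) ⟩
        (⟦ 1ℚ ⟧ * ⟦ 1ℚ ⟧ + ⟦ ℚ.- 1ℚ ⟧ * ⟦ 0ℚ ⟧) - (⟦ 1ℚ ⟧ * ⟦ 0ℚ ⟧ + ⟦ ℚ.- 1ℚ ⟧ * ⟦ 1ℚ ⟧)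
          ≈⟨ solve 0 ((con 1ℚ :* con 1ℚ :+ con (ℚ.- 1ℚ) :* con 0ℚ) :- (con 1ℚ :* con 0ℚ :+ con (ℚ.- 1ℚ) :* con 1ℚ)
               := con (ℕ→ℚ 2)) ≈-refl ⟩
        ⟦ ℕ→ℚ 2 ⟧ ∎
        where
        Ixx≈1 = ≈-trans (I-diagonal x) (≈-sym 1-homo)
        Izz≈1 = ≈-trans (I-diagonal z) (≈-sym 1-homo)
        Ixz≈0 = ≈-trans (I-offDiagonal x≢z) (≈-sym 0-homo)
        Izx≈0 = ≈-trans (I-offDiagonal (≡.≢-sym x≢z)) (≈-sym 0-homo)

      ⟨edgeVector,A·edgeVector⟩ : ⟨ edgeVector , A · edgeVector ⟩ ≈ ⟦ ℚ.- ℕ→ℚ 2 ⟧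
      ⟨edgeVector,A·edgeVector⟩ = begin
        ⟨ edgeVector , A · edgeVector ⟩
          ≈⟨ ⟨edgeVector, A · edgeVector ⟩ ⟩
        (A · edgeVector) x - (A · edgeVector) z
          ≈⟨ +-cong (row x) (-‿cong (row z)) ⟩
        (A x x - A x z) - (A z x - A z z)
          ≈⟨ +-cong (+-cong Axx (-‿cong Axz)) (-‿cong (+-cong Azx (-‿cong Azz))) ⟩
        (⟦ 0ℚ ⟧ - ⟦ 1ℚ ⟧) - (⟦ 1ℚ ⟧ - ⟦ 0ℚ ⟧)
          ≈⟨ solve 0 ((con 0ℚ :- con 1ℚ) :- (con 1ℚ :- con 0ℚ) := con (ℚ.- ℕ→ℚ 2)) ≈-refl ⟩
        ⟦ ℚ.- ℕ→ℚ 2 ⟧ ∎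
        where
        row : ∀ y → (A · edgeVector) y ≈ A y x - A y z
        row y = ≈-trans (⟨⟩-comm (A y) edgeVector) ⟨edgeVector, A y ⟩
        Axx = ≈-trans Axx≈0 (≈-sym 0-homo)
        Azz = ≈-trans Azz≈0 (≈-sym 0-homo)
        Axz = ≈-trans Axz≈1 (≈-sym 1-homo)
        Azx = ≈-trans (A-sym z x) Axz

    -- The distance form on 𝟙^⊥

    module Extremal (k ℓ μ : Carrier) (A1≈k : ∀ x → ⟨ A x , 1ᵥ ⟩ ≈ k)
                    (A² : ∀ x y → sum (λ z → A x z * A z y) ≈ (ℓ - μ) * A x y + (k - μ) * I x y + μ)
                    (D : Matrix n)
                    (D≈ : ∀ x y → D x y ≈ ⟦ ℚ.- 1ℚ ⟧ * A x y + ⟦ ℚ.- ℕ→ℚ 2 ⟧ * I x y + ⟦ ℕ→ℚ 2 ⟧)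
                    (s : Carrier)
                    (s² : s * s ≈ (ℓ - μ) * (ℓ - μ) + ⟦ ℕ→ℚ 4 ⟧ * (k - μ)) where

      b m τ θ : Carrier
      b = ℓ - μ
      m = k - μ
      τ = (b - s) * ⟦ ½ ⟧
      θ = (b + s) * ⟦ ½ ⟧

      -- Here the value of s² enters: -τθ = (s² - b²)/4, and s² - b² = 4m.
      -τθ≈m : - (τ * θ) ≈ m
      -τθ≈m = begin
        - (τ * θ)
          ≈⟨ solve 2 (λ b s → :- (((b :- s) :* con ½) :* ((b :+ s) :* con ½))
               := (s :* s :- b :* b) :* con (½ ℚ.* ½)) ≈-refl b s ⟩
        (s * s - b * b) * ⟦ ½ ℚ.* ½ ⟧
          ≈⟨ *-congʳ (+-congʳ s²) ⟩
        ((b * b + ⟦ ℕ→ℚ 4 ⟧ * m) - b * b) * ⟦ ½ ℚ.* ½ ⟧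
          ≈⟨ solve 2 (λ b m → ((b :* b :+ con (ℕ→ℚ 4) :* m) :- b :* b) :* con (½ ℚ.* ½) := m) ≈-refl b m ⟩
        m ∎

      -- Used for both orders of the roots, since `norm-shift` and `shift-eigen` treat ρ and σ
      -- differently.
      A·A· : ∀ ρ σ → ρ + σ ≈ b → - (ρ * σ) ≈ m → ∀ f → ⟨ 1ᵥ , f ⟩ ≈ 0# →
             A · (A · f) ≋ comb (ρ + σ) (A · f) (- (ρ * σ)) f
      A·A· ρ σ ρ+σ≈b -ρσ≈m f f⊥1 x = begin
        (A · A · f) x                                 ≈⟨ ⟨⟩-assoc (A x) A f ⟩
        ((λ u y → sum (λ z → A u z * A z y)) · f) x   ≈⟨ span-action A (λ u y → sum (λ z → A u z * A z y)) b m μ A² f f⊥1 x ⟩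
        b * (A · f) x + m * f x                       ≈⟨ +-cong (*-congʳ ρ+σ≈b) (*-congʳ -ρσ≈m) ⟨
        comb (ρ + σ) (A · f) (- (ρ * σ)) f x          ∎

      τ+θ≈b : τ + θ ≈ b
      τ+θ≈b = solve 2 (λ b s → (b :- s) :* con ½ :+ (b :+ s) :* con ½ := b) ≈-refl b s

      A·A·τθ : ∀ f → ⟨ 1ᵥ , f ⟩ ≈ 0# → A · (A · f) ≋ comb (τ + θ) (A · f) (- (τ * θ)) f
      A·A·τθ = A·A· τ θ τ+θ≈b -τθ≈m

      A·A·θτ : ∀ f → ⟨ 1ᵥ , f ⟩ ≈ 0# → A · (A · f) ≋ comb (θ + τ) (A · f) (- (θ * τ)) f
      A·A·θτ = A·A· θ τ (≈-trans (+-comm θ τ) τ+θ≈b) (≈-trans (-‿cong (*-comm θ τ)) -τθ≈m)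

      ⟨f,Df⟩ : ∀ f → ⟨ 1ᵥ , f ⟩ ≈ 0# →
               ⟨ f , D · f ⟩ ≈ ⟦ ℚ.- 1ℚ ⟧ * ⟨ f , A · f ⟩ + ⟦ ℚ.- ℕ→ℚ 2 ⟧ * ⟨ f , f ⟩
      ⟨f,Df⟩ f f⊥1 = ≈-trans
        (⟨⟩-congʳ f (span-action A D ⟦ ℚ.- 1ℚ ⟧ ⟦ ℚ.- ℕ→ℚ 2 ⟧ ⟦ ℕ→ℚ 2 ⟧ D≈ f f⊥1))
        (⟨⟩-combʳ f ⟦ ℚ.- 1ℚ ⟧ (A · f) ⟦ ℚ.- ℕ→ℚ 2 ⟧ f)

      -- Chosen so that s + c = 2(θ + 1), the factor that appears in the norm of the maximiser.
      c : Carrier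
      c = ⟦ ℕ→ℚ 2 ⟧ + b

      -- For a unit vector the gap is ⟨f, Af⟩ - τ, and `norm-shift` computes s times it. As t is the
      -- inverse of s², the product `t * s` takes the place of 1/s.
      upper-gap : ∀ t → t * (s * s) ≈ 1# → ∀ f → ⟨ f , f ⟩ ≈ 1# → ⟨ 1ᵥ , f ⟩ ≈ 0# →
                  (- ⟦ ℕ→ℚ 2 ⟧ - τ) - ⟨ f , D · f ⟩ ≈ (t * s) * ⟨ shift τ f , shift τ f ⟩
      upper-gap t ts²≈1 f ⟨f,f⟩≈1 f⊥1 = begin
        (- ⟦ ℕ→ℚ 2 ⟧ - τ) - ⟨ f , D · f ⟩
          ≈⟨ +-congˡ (-‿cong (≈-trans (⟨f,Df⟩ f f⊥1) (+-congˡ (*-congˡ Q≈1)))) ⟩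
        (- ⟦ ℕ→ℚ 2 ⟧ - τ) - (⟦ ℚ.- 1ℚ ⟧ * P + ⟦ ℚ.- ℕ→ℚ 2 ⟧ * ⟦ 1ℚ ⟧)
          ≈⟨ solve 2 (λ τ P → (:- con (ℕ→ℚ 2) :- τ) :- (con (ℚ.- 1ℚ) :* P :+ con (ℚ.- ℕ→ℚ 2) :* con 1ℚ)
               := con 1ℚ :* (P :- τ)) ≈-refl τ P ⟩
        ⟦ 1ℚ ⟧ * (P - τ)
          -- Inserting 1 = t s² supplies one factor s for t s and one for θ - τ = s.
          ≈⟨ *-congʳ (≈-trans ts²≈1 (≈-sym 1-homo)) ⟨
        t * (s * s) * (P - τ)
          ≈⟨ solve 4 (λ t s b P → t :* (s :* s) :* (P :- (b :- s) :* con ½)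
               := (t :* s) :* (((b :+ s) :* con ½ :- (b :- s) :* con ½) :* (P :- (b :- s) :* con ½ :* con 1ℚ)))
               ≈-refl t s b P ⟩
        (t * s) * ((θ - τ) * (P - τ * ⟦ 1ℚ ⟧))
          ≈⟨ *-congˡ (*-congˡ (+-congˡ (-‿cong (*-congˡ Q≈1)))) ⟨
        (t * s) * ((θ - τ) * (P - τ * ⟨ f , f ⟩))
          ≈⟨ *-congˡ (norm-shift τ θ f (A·A·τθ f f⊥1)) ⟨
        (t * s) * ⟨ shift τ f , shift τ f ⟩ ∎
        where
        P = ⟨ f , A · f ⟩
        Q≈1 = ≈-trans ⟨f,f⟩≈1 (≈-sym 1-homo)

      module Witness (x z : Fin n) (x≢z : x ≢ z)
                     (Axx≈0 : A x x ≈ 0#) (Azz≈0 : A z z ≈ 0#) (Axz≈1 : A x z ≈ 1#) where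

        open Edge x z x≢z Axx≈0 Azz≈0 Axz≈1

        -- The scalar `r` will be the reciprocal of the norm of `shift θ edgeVector`.
        extremal : Carrier → Vector n
        extremal r y = r * shift θ edgeVector y

        extremal-⊥1 : ∀ r → ⟨ 1ᵥ , extremal r ⟩ ≈ 0#
        extremal-⊥1 r = ≈-trans (⟨⟩-scaleʳ r 1ᵥ (shift θ edgeVector))
          (≈-trans (*-congˡ (shift-⊥1 k A1≈k θ edgeVector edgeVector-⊥1)) (zeroʳ r))

        ⟨extremal,extremal⟩ : ∀ r → ⟨ extremal r , extremal r ⟩ ≈ r * r * (s * (s + c))
        ⟨extremal,extremal⟩ r = begin
          ⟨ extremal r , extremal r ⟩
            ≈⟨ ⟨⟩-scaleʳ r (extremal r) h ⟩
          r * ⟨ extremal r , h ⟩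
            ≈⟨ *-congˡ (≈-trans (⟨⟩-comm (extremal r) h) (⟨⟩-scaleʳ r h h)) ⟩
          r * (r * ⟨ h , h ⟩)
            -- With the roots exchanged, both factors are negated: τ - θ = -s and -2 - 2θ = -(s +
            -- c).
            ≈⟨ *-congˡ (*-congˡ (norm-shift θ τ edgeVector (A·A·θτ edgeVector edgeVector-⊥1))) ⟩
          r * (r * ((τ - θ) * (⟨ edgeVector , A · edgeVector ⟩ - θ * ⟨ edgeVector , edgeVector ⟩)))
            ≈⟨ *-congˡ (*-congˡ (*-congˡ (+-cong ⟨edgeVector,A·edgeVector⟩ (-‿cong (*-congˡ ⟨edgeVector,edgeVector⟩))))) ⟩
          r * (r * ((τ - θ) * (⟦ ℚ.- ℕ→ℚ 2 ⟧ - θ * ⟦ ℕ→ℚ 2 ⟧)))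
            ≈⟨ solve 3 (λ r b s →
                 r :* (r :* (((b :- s) :* con ½ :- (b :+ s) :* con ½) :* (con (ℚ.- ℕ→ℚ 2) :- (b :+ s) :* con ½ :* con (ℕ→ℚ 2))))
                 := r :* r :* (s :* (s :+ (con (ℕ→ℚ 2) :+ b)))) ≈-refl r b s ⟩
          r * r * (s * (s + c)) ∎
          where h = shift θ edgeVector

        extremal-value : ∀ r → ⟨ extremal r , extremal r ⟩ ≈ 1# →
                         ⟨ extremal r , D · extremal r ⟩ ≈ - ⟦ ℕ→ℚ 2 ⟧ - τ
        extremal-value r Q≈1 = begin
          ⟨ f , D · f ⟩
            ≈⟨ ⟨f,Df⟩ f (extremal-⊥1 r) ⟩
          ⟦ ℚ.- 1ℚ ⟧ * ⟨ f , A · f ⟩ + ⟦ ℚ.- ℕ→ℚ 2 ⟧ * ⟨ f , f ⟩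
            ≈⟨ +-congʳ (*-congˡ (≈-trans (⟨⟩-congʳ f Af≋τf) (⟨⟩-scaleʳ τ f f))) ⟩
          ⟦ ℚ.- 1ℚ ⟧ * (τ * ⟨ f , f ⟩) + ⟦ ℚ.- ℕ→ℚ 2 ⟧ * ⟨ f , f ⟩
            ≈⟨ +-cong (*-congˡ (*-congˡ Q≈⟦1⟧)) (*-congˡ Q≈⟦1⟧) ⟩
          ⟦ ℚ.- 1ℚ ⟧ * (τ * ⟦ 1ℚ ⟧) + ⟦ ℚ.- ℕ→ℚ 2 ⟧ * ⟦ 1ℚ ⟧
            ≈⟨ solve 1 (λ τ → con (ℚ.- 1ℚ) :* (τ :* con 1ℚ) :+ con (ℚ.- ℕ→ℚ 2) :* con 1ℚ
                 := :- con (ℕ→ℚ 2) :- τ) ≈-refl τ ⟩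
          - ⟦ ℕ→ℚ 2 ⟧ - τ ∎
          where
          f = extremal r
          Q≈⟦1⟧ = ≈-trans Q≈1 (≈-sym 1-homo)
          Af≋τf : A · f ≋ λ y → τ * f y
          Af≋τf y = begin
            ⟨ A y , f ⟩                        ≈⟨ ⟨⟩-scaleʳ r (A y) (shift θ edgeVector) ⟩
            r * (A · shift θ edgeVector) y     ≈⟨ *-congˡ (shift-eigen τ θ edgeVector (A·A·τθ edgeVector edgeVector-⊥1) y) ⟩
            r * (τ * shift θ edgeVector y)     ≈⟨ solve 3 (λ r τ h → r :* (τ :* h) := τ :* (r :* h)) ≈-refl r τ (shift θ edgeVector y) ⟩
            τ * f y                            ∎

  -- Matrices constant on the three relations of equality, adjacency and non-adjacency are spanned
  -- by I, A and the all-ones matrix. The last contributes γ everywhere, which is why the other two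
  -- values are given as β + γ and α + γ.
  byRelation : ∀ {n} (a : Fin n → Fin n → Bool) → (∀ x → a x x ≡ false) → ∀ (M : Matrix n) α β γ →
    (∀ x → M x x ≈ β + γ) → (∀ x y → a x y ≡ true → M x y ≈ α + γ) →
    (∀ x y → x ≢ y → a x y ≡ false → M x y ≈ γ) →
    ∀ x y → M x y ≈ α * booleanMatrix a x y + β * I x y + γ
  byRelation a a-irrefl M α β γ diagonal adj nonadj x y with x ≟ᶠ y | a x y in axy
  ... | yes refl | true  = contradiction (≡.trans (≡.sym axy) (a-irrefl x)) λ ()
  ... | yes refl | false = ≈-trans (diagonal x) (+-congʳ
    (≈-sym (≈-trans (+-cong (zeroʳ α) (*-identityʳ β)) (+-identityˡ β))))
  ... | no x≢y   | true  = ≈-trans (adj x y axy) (+-congʳ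
    (≈-sym (≈-trans (+-cong (*-identityʳ α) (zeroʳ β)) (+-identityʳ α))))
  ... | no x≢y   | false = ≈-trans (nonadj x y x≢y axy) (≈-sym
    (≈-trans (+-congʳ (≈-trans (+-cong (zeroʳ α) (zeroʳ β)) (+-identityˡ 0#))) (+-identityˡ γ)))

  -- Adjacency and distance matrices of a strongly regular graph

  module StronglyRegular {n} (a : Fin n → Fin n → Bool)
    (a-sym : ∀ x y → a x y ≡ a y x) (a-irrefl : ∀ x → a x x ≡ false) (k ℓ μ : ℕ)
    (regular : ∀ x → ∣ tabulate (a x) ∣ ≡ k)
    (adjacent : ∀ x y → a x y ≡ true → ∣ tabulate (a x) ∩ tabulate (a y) ∣ ≡ ℓ)
    (nonadjacent : ∀ x y → x ≢ y → a x y ≡ false → ∣ tabulate (a x) ∩ tabulate (a y) ∣ ≡ μ)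
    (D : Matrix n) (D-diagonal : ∀ x → D x x ≈ ⟦ ℕ→ℚ 0 ⟧) (D-adjacent : ∀ x y → a x y ≡ true → D x y ≈ ⟦ ℕ→ℚ 1 ⟧)
    (D-nonadjacent : ∀ x y → x ≢ y → a x y ≡ false → D x y ≈ ⟦ ℕ→ℚ 2 ⟧)
    (s : Carrier)
    (s² : s * s ≈ (⟦ ℕ→ℚ ℓ ⟧ - ⟦ ℕ→ℚ μ ⟧) * (⟦ ℕ→ℚ ℓ ⟧ - ⟦ ℕ→ℚ μ ⟧) + ⟦ ℕ→ℚ 4 ⟧ * (⟦ ℕ→ℚ k ⟧ - ⟦ ℕ→ℚ μ ⟧)) where

    private
      A : Matrix n
      A = booleanMatrix a

      A² : ∀ x y → sum (λ z → A x z * A z y) ≈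
           (⟦ ℕ→ℚ ℓ ⟧ - ⟦ ℕ→ℚ μ ⟧) * A x y + (⟦ ℕ→ℚ k ⟧ - ⟦ ℕ→ℚ μ ⟧) * I x y + ⟦ ℕ→ℚ μ ⟧
      A² = byRelation a a-irrefl (λ x y → sum (λ z → A x z * A z y)) _ _ _
        -- On the diagonal the common neighbours of x with itself are its k neighbours, and k is
        -- split as (k - μ) + μ.
        (λ x → ≈-trans (booleanMatrix-square a a-sym x x (≡.trans (cong ∣_∣ (∩-idem (tabulate (a x)))) (regular x)))
          (u≈[u-v]+v ⟦ ℕ→ℚ k ⟧))
        (λ x y axy → ≈-trans (booleanMatrix-square a a-sym x y (adjacent x y axy)) (u≈[u-v]+v ⟦ ℕ→ℚ ℓ ⟧))
        (λ x y x≢y axy → booleanMatrix-square a a-sym x y (nonadjacent x y x≢y axy))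
        where
        u≈[u-v]+v : ∀ u → u ≈ (u - ⟦ ℕ→ℚ μ ⟧) + ⟦ ℕ→ℚ μ ⟧
        u≈[u-v]+v u = solve 2 (λ u v → u := (u :- v) :+ v) ≈-refl u ⟦ ℕ→ℚ μ ⟧

      D≈ : ∀ x y → D x y ≈ ⟦ ℚ.- 1ℚ ⟧ * A x y + ⟦ ℚ.- ℕ→ℚ 2 ⟧ * I x y + ⟦ ℕ→ℚ 2 ⟧
      D≈ = byRelation a a-irrefl D _ _ _
        -- The distances 0 and 1 are split as -2 + 2 and -1 + 2.
        (λ x → ≈-trans (D-diagonal x) (+-homo (ℚ.- ℕ→ℚ 2) (ℕ→ℚ 2)))
        (λ x y axy → ≈-trans (D-adjacent x y axy) (+-homo (ℚ.- 1ℚ) (ℕ→ℚ 2)))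
        D-nonadjacent

      module E = Extremal A (booleanMatrix-sym a a-sym) ⟦ ℕ→ℚ k ⟧ ⟦ ℕ→ℚ ℓ ⟧ ⟦ ℕ→ℚ μ ⟧
        (λ x → booleanMatrix-1ᵥ a x (regular x)) A² D D≈ s s²

    maximum : Carrier
    maximum = - ⟦ ℕ→ℚ 2 ⟧ - ((⟦ ℕ→ℚ ℓ ⟧ - ⟦ ℕ→ℚ μ ⟧) - s) * ⟦ ½ ⟧

    -- The vector D · f enters up to ≋, as g, so that an instance over ℝ can supply its own
    -- matrix-vector product for g without a conversion check between the two products.
    maximum-gap : ∀ t → t * (s * s) ≈ 1# → ∀ f g → g ≋ D · f → ⟨ f , f ⟩ ≈ 1# → sum f ≈ 0# →
                  ∃ λ (h : Vector n) → maximum - ⟨ f , g ⟩ ≈ (t * s) * ⟨ h , h ⟩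
    maximum-gap t ts²≈1 f g g≋Df ⟨f,f⟩≈1 ∑f≈0 = shift A (booleanMatrix-sym a a-sym) E.τ f ,
      ≈-trans (+-congˡ (-‿cong (⟨⟩-congʳ f g≋Df)))
        (E.upper-gap t ts²≈1 f ⟨f,f⟩≈1 (≈-trans (⟨1ᵥ, f ⟩) ∑f≈0))

    maximum-attained : ∀ r → r * r * (s * (s + (⟦ ℕ→ℚ 2 ⟧ + (⟦ ℕ→ℚ ℓ ⟧ - ⟦ ℕ→ℚ μ ⟧)))) ≈ 1# →
      ∀ x z → a x z ≡ true →
      ∃ λ f → (⟨ f , f ⟩ ≈ 1# × sum f ≈ 0#) × (∀ g → g ≋ D · f → ⟨ f , g ⟩ ≈ maximum)
    maximum-attained r r²N≈1 x z axz = W.extremal r ,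
      (unit , ≈-trans (≈-sym ⟨1ᵥ, W.extremal r ⟩) (W.extremal-⊥1 r)) ,
      λ g g≋Df → ≈-trans (⟨⟩-congʳ (W.extremal r) g≋Df) (W.extremal-value r unit)
      where
      x≢z : x ≢ z
      x≢z refl = contradiction (≡.trans (≡.sym axz) (a-irrefl x)) λ ()
      entry : ∀ {u v b} → a u v ≡ b → A u v ≈ indicator b
      entry auv = ≈-reflexive (cong indicator auv)
      module W = E.Witness x z x≢z (entry (a-irrefl x)) (entry (a-irrefl z)) (entry axz)
      unit : ⟨ W.extremal r , W.extremal r ⟩ ≈ 1#
      unit = ≈-trans (W.⟨extremal,extremal⟩ r) r²N≈1

open import Defs

-- The ordered ring ℝ

module _ where
  open +-*-Solver using (solve; _:+_; _:*_; :-_; _:-_; _:=_)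

  p²≥0 : ∀ p → 0ℚ ℚ.≤ p ℚ.* p
  p²≥0 p with ℚP.≤-total 0ℚ p
  ... | inj₁ 0≤p = *-mono-≤ 0≤p ℚP.≤-refl 0≤p 0≤p
  ... | inj₂ p≤0 = subst (0ℚ ℚ.≤_) (solve 1 (λ p → :- p :* :- p := p :* p) refl p)
                     (*-mono-≤ 0≤-p ℚP.≤-refl 0≤-p 0≤-p)
    where
    0≤-p : 0ℚ ℚ.≤ ℚ.- p
    0≤-p = ℚP.neg-antimono-≤ p≤0

  -- Operations on ℝ act term by term, so ring laws transfer from ℚ through this; only the
  -- congruences take an ε-argument.
  ≗⇒≃ : ∀ x y → (∀ n → seq x n ≡ seq y n) → x ≃ y
  ≗⇒≃ x y x≗y ε 0<ε = 0 , λ n _ → subst (ℚ._< ε)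
    (cong ℚ.∣_∣ (≡.trans (≡.sym (ℚP.+-inverseʳ (seq x n))) (cong (λ z → seq x n ℚ.- z) (x≗y n)))) 0<ε

  ≃-refl : ∀ {x} → x ≃ x
  ≃-refl {x} = ≗⇒≃ x x λ _ → refl

  ≃-sym : ∀ {x y} → x ≃ y → y ≃ x
  ≃-sym {x} {y} x≃y ε 0<ε =
    let N , h = x≃y ε 0<ε
    in N , λ n n≥ → subst (ℚ._< ε) (∣p-q∣-comm (seq x n) (seq y n)) (h n n≥)

  ∣+∣<ε : ∀ {ε} p q → ℚ.∣ p ∣ ℚ.< ε ℚ.* ½ → ℚ.∣ q ∣ ℚ.< ε ℚ.* ½ → ℚ.∣ p ℚ.+ q ∣ ℚ.< ε
  ∣+∣<ε {ε} p q hp hq = ℚP.≤-<-trans (ℚP.∣p+q∣≤∣p∣+∣q∣ p q)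
    (subst (ℚ.∣ p ∣ ℚ.+ ℚ.∣ q ∣ ℚ.<_) (half+half ε) (ℚP.+-mono-< hp hq))

  ≃-trans : ∀ {x y z} → x ≃ y → y ≃ z → x ≃ z
  ≃-trans {x} {y} {z} x≃y y≃z ε 0<ε =
    let M , h = x≃y (ε ℚ.* ½) (half-pos 0<ε)
        N , k = y≃z (ε ℚ.* ½) (half-pos 0<ε)
    in M ℕ.+ N , λ n n≥ → subst (λ t → ℚ.∣ t ∣ ℚ.< ε)
         (solve 3 (λ a b c → (a :- b) :+ (b :- c) := a :- c) refl (seq x n) (seq y n) (seq z n))
         (∣+∣<ε (seq x n ℚ.- seq y n) (seq y n ℚ.- seq z n)
           (h n (ℕP.m+n≤o⇒m≤o M n≥)) (k n (ℕP.m+n≤o⇒n≤o M n≥)))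

  +-cong : ∀ {x y u v} → x ≃ y → u ≃ v → x + u ≃ y + v
  +-cong {x} {y} {u} {v} x≃y u≃v ε 0<ε =
    let M , h = x≃y (ε ℚ.* ½) (half-pos 0<ε)
        N , k = u≃v (ε ℚ.* ½) (half-pos 0<ε)
    in M ℕ.+ N , λ n n≥ → subst (λ t → ℚ.∣ t ∣ ℚ.< ε)
         (solve 4 (λ a b c d → (a :- b) :+ (c :- d) := (a :+ c) :- (b :+ d)) refl
           (seq x n) (seq y n) (seq u n) (seq v n))
         (∣+∣<ε (seq x n ℚ.- seq y n) (seq u n ℚ.- seq v n)
           (h n (ℕP.m+n≤o⇒m≤o M n≥)) (k n (ℕP.m+n≤o⇒n≤o M n≥)))

  -‿cong : ∀ {x y} → x ≃ y → - x ≃ - y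
  -‿cong {x} {y} x≃y ε 0<ε =
    let N , h = x≃y ε 0<ε
    in N , λ n n≥ → subst (ℚ._< ε)
         (≡.trans (∣p-q∣-comm (seq x n) (seq y n))
           (cong ℚ.∣_∣ (solve 2 (λ a b → b :- a := :- a :- :- b) refl (seq x n) (seq y n))))
         (h n n≥)

  *-comm : ∀ x y → x * y ≃ y * x
  *-comm x y = ≗⇒≃ (x * y) (y * x) λ n → ℚP.*-comm (seq x n) (seq y n)

  *-congˡ : ∀ x {u v} → u ≃ v → x * u ≃ x * v
  *-congˡ x {u} {v} u≃v ε 0<ε =
    let B , M , 0<B , hB = bounded x
        instance
          posB = ℚ.positive 0<B
          nzB  = ℚP.pos⇒nonZero B
        -- Eventually |x| ≤ B, so multiplication by x enlarges a difference below ε/B to at most one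
        -- below ε.
        δ   = ε ℚ.* ℚ.1/ B
        0<δ = *-pos 0<ε (ℚP.positive⁻¹ (ℚ.1/ B) {{ℚP.1/pos⇒pos B}})
        N , h = u≃v δ 0<δ
    in M ℕ.+ N , λ n n≥ →
      let a = seq x n ; c = seq u n ; d = seq v n in begin-strict
      ℚ.∣ a ℚ.* c ℚ.- a ℚ.* d ∣
        ≡⟨ cong ℚ.∣_∣ (solve 3 (λ a c d → a :* c :- a :* d := a :* (c :- d)) refl a c d) ⟩
      ℚ.∣ a ℚ.* (c ℚ.- d) ∣
        ≡⟨ ℚP.∣p*q∣≡∣p∣*∣q∣ a (c ℚ.- d) ⟩
      ℚ.∣ a ∣ ℚ.* ℚ.∣ c ℚ.- d ∣
        ≤⟨ ℚP.*-monoʳ-≤-nonNeg ℚ.∣ c ℚ.- d ∣ {{ℚP.∣-∣-nonNeg (c ℚ.- d)}} (hB n (ℕP.m+n≤o⇒m≤o M n≥)) ⟩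
      B ℚ.* ℚ.∣ c ℚ.- d ∣
        <⟨ ℚP.*-monoʳ-<-pos B (h n (ℕP.m+n≤o⇒n≤o M n≥)) ⟩
      B ℚ.* δ
        ≡⟨ solve 3 (λ b e i → b :* (e :* i) := e :* (b :* i)) refl B ε (ℚ.1/ B) ⟩
      ε ℚ.* (B ℚ.* ℚ.1/ B)
        ≡⟨ cong (ε ℚ.*_) (ℚP.*-inverseʳ B) ⟩
      ε ℚ.* 1ℚ
        ≡⟨ ℚP.*-identityʳ ε ⟩
      ε ∎
    where open ℚP.≤-Reasoning

  *-cong : ∀ {x y u v} → x ≃ y → u ≃ v → x * u ≃ y * v
  *-cong {x} {y} {u} {v} x≃y u≃v = ≃-trans {x * u} {x * v} {y * v} (*-congˡ x {u} {v} u≃v)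
    (≃-trans {x * v} {v * x} {y * v} (*-comm x v)
      (≃-trans {v * x} {v * y} {y * v} (*-congˡ v {x} {y} x≃y) (*-comm v y)))

ℝ-commutativeRing : CommutativeRing 0ℓ 0ℓ
ℝ-commutativeRing = record
  { Carrier = ℝ ; _≈_ = _≃_ ; _+_ = _+_ ; _*_ = _*_ ; -_ = -_ ; 0# = fromℕ 0 ; 1# = fromℕ 1
  ; isCommutativeRing = record
    { isRing = record
      { +-isAbelianGroup = record
        { isGroup = record
          { isMonoid = record
            { isSemigroup = record
              { isMagma = record
                { isEquivalence = record
                  { refl  = λ {x} → ≃-refl {x}
                  ; sym   = λ {x} {y} → ≃-sym {x} {y}
                  ; trans = λ {x} {y} {z} → ≃-trans {x} {y} {z}
                  }
                ; ∙-cong = λ {x} {y} {u} {v} → +-cong {x} {y} {u} {v}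
                }
              ; assoc = λ x y z → ≗⇒≃ ((x + y) + z) (x + (y + z)) λ n → ℚP.+-assoc (seq x n) (seq y n) (seq z n)
              }
            ; identity = (λ x → ≗⇒≃ (fromℕ 0 + x) x λ n → ℚP.+-identityˡ (seq x n))
                       , (λ x → ≗⇒≃ (x + fromℕ 0) x λ n → ℚP.+-identityʳ (seq x n))
            }
          ; inverse = (λ x → ≗⇒≃ (- x + x) (fromℕ 0) λ n → ℚP.+-inverseˡ (seq x n))
                    , (λ x → ≗⇒≃ (x + - x) (fromℕ 0) λ n → ℚP.+-inverseʳ (seq x n))
          ; ⁻¹-cong = λ {x} {y} → -‿cong {x} {y}
          }
        ; comm = λ x y → ≗⇒≃ (x + y) (y + x) λ n → ℚP.+-comm (seq x n) (seq y n)
        }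
      ; *-cong     = λ {x} {y} {u} {v} → *-cong {x} {y} {u} {v}
      ; *-assoc    = λ x y z → ≗⇒≃ ((x * y) * z) (x * (y * z)) λ n → ℚP.*-assoc (seq x n) (seq y n) (seq z n)
      ; *-identity = (λ x → ≗⇒≃ (fromℕ 1 * x) x λ n → ℚP.*-identityˡ (seq x n))
                   , (λ x → ≗⇒≃ (x * fromℕ 1) x λ n → ℚP.*-identityʳ (seq x n))
      ; distrib    = (λ x y z → ≗⇒≃ (x * (y + z)) (x * y + x * z)
                        λ n → ℚP.*-distribˡ-+ (seq x n) (seq y n) (seq z n))
                   , (λ x y z → ≗⇒≃ ((y + z) * x) (y * x + z * x)
                        λ n → ℚP.*-distribʳ-+ (seq x n) (seq y n) (seq z n))
      }
    ; *-comm = *-comm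
    }
  }

fromℚ-homomorphism : ℚ-rawRing -Raw-AlmostCommutative⟶ fromCommutativeRing ℝ-commutativeRing
fromℚ-homomorphism = record
  { ⟦_⟧    = fromℚ
  ; +-homo = λ p q → ≗⇒≃ (fromℚ (p ℚ.+ q)) (fromℚ p + fromℚ q) λ _ → refl
  ; *-homo = λ p q → ≗⇒≃ (fromℚ (p ℚ.* q)) (fromℚ p * fromℚ q) λ _ → refl
  ; -‿homo = λ p → ≗⇒≃ (fromℚ (ℚ.- p)) (- fromℚ p) λ _ → refl
  ; 0-homo = ≗⇒≃ (fromℚ 0ℚ) (fromℕ 0) λ _ → refl
  ; 1-homo = ≗⇒≃ (fromℚ 1ℚ) (fromℕ 1) λ _ → refl
  }

-- Order and square roots in ℝ

module _ where
  open +-*-Solver using (solve; _:+_; _:*_; _:-_; _:=_)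

  seq-≤⇒≤ : ∀ x y → (∀ n → seq x n ℚ.≤ seq y n) → x ≤ y
  seq-≤⇒≤ x y x≤y ε 0<ε = 0 , λ n _ →
    subst (ℚ._< seq y n ℚ.+ ε) (ℚP.+-identityʳ (seq x n)) (ℚP.+-mono-≤-< (x≤y n) 0<ε)

  ≤-respʳ-≃ : ∀ x y z → y ≃ z → x ≤ y → x ≤ z
  ≤-respʳ-≃ x y z y≃z x≤y ε 0<ε =
    let M , h = x≤y (ε ℚ.* ½) (half-pos 0<ε)
        N , k = y≃z (ε ℚ.* ½) (half-pos 0<ε)
    in M ℕ.+ N , λ n n≥ → begin-strict
      seq x n
        <⟨ h n (ℕP.m+n≤o⇒m≤o M n≥) ⟩
      seq y n ℚ.+ ε ℚ.* ½
        ≡⟨ solve 3 (λ y z e → y :+ e := z :+ e :+ (y :- z)) refl (seq y n) (seq z n) (ε ℚ.* ½) ⟩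
      seq z n ℚ.+ ε ℚ.* ½ ℚ.+ (seq y n ℚ.- seq z n)
        <⟨ ℚP.+-monoʳ-< (seq z n ℚ.+ ε ℚ.* ½) (ℚP.≤-<-trans (p≤∣p∣ _) (k n (ℕP.m+n≤o⇒n≤o M n≥))) ⟩
      seq z n ℚ.+ ε ℚ.* ½ ℚ.+ ε ℚ.* ½
        ≡⟨ ≡.trans (ℚP.+-assoc (seq z n) _ _) (cong (seq z n ℚ.+_) (half+half ε)) ⟩
      seq z n ℚ.+ ε ∎
    where open ℚP.≤-Reasoning

  0≤y-x⇒x≤y : ∀ x y → fromℕ 0 ≤ y - x → x ≤ y
  0≤y-x⇒x≤y x y 0≤y-x ε 0<ε =
    let N , h = 0≤y-x ε 0<ε
    in N , λ n n≥ → subst₂ ℚ._<_ (ℚP.+-identityʳ (seq x n))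
         (solve 3 (λ x y e → x :+ (y :- x :+ e) := y :+ e) refl (seq x n) (seq y n) ε)
         (ℚP.+-monoʳ-< (seq x n) (h n n≥))

  x≤y⇒0≤y-x : ∀ x y → x ≤ y → fromℕ 0 ≤ y - x
  x≤y⇒0≤y-x x y x≤y ε 0<ε =
    let N , h = x≤y ε 0<ε
    in N , λ n n≥ → subst₂ ℚ._<_ (ℚP.+-inverseʳ (seq x n))
         (solve 3 (λ x y e → (y :+ e) :- x := y :- x :+ e) refl (seq x n) (seq y n) ε)
         (ℚP.+-monoˡ-< (ℚ.- seq x n) (h n n≥))

  0≤x+y : ∀ x y → fromℕ 0 ≤ x → fromℕ 0 ≤ y → fromℕ 0 ≤ x + y
  0≤x+y x y 0≤x 0≤y ε 0<ε =
    let M , h = 0≤x (ε ℚ.* ½) (half-pos 0<ε)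
        N , k = 0≤y (ε ℚ.* ½) (half-pos 0<ε)
    in M ℕ.+ N , λ n n≥ → subst (0ℚ ℚ.<_)
         (≡.trans (solve 3 (λ x y e → (x :+ e) :+ (y :+ e) := x :+ y :+ (e :+ e)) refl (seq x n) (seq y n) (ε ℚ.* ½))
           (cong (seq x n ℚ.+ seq y n ℚ.+_) (half+half ε)))
         (ℚP.+-mono-< (h n (ℕP.m+n≤o⇒m≤o M n≥)) (k n (ℕP.m+n≤o⇒n≤o M n≥)))

  0≤x² : ∀ x → fromℕ 0 ≤ x * x
  0≤x² x = seq-≤⇒≤ (fromℕ 0) (x * x) λ n → p²≥0 (seq x n)

  -- x y = (√x √y)².
  0≤x*y : ∀ x y → fromℕ 0 ≤ x → fromℕ 0 ≤ y → fromℕ 0 ≤ x * y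
  0≤x*y x y 0≤x 0≤y = ≤-respʳ-≃ (fromℕ 0) ((√ x * √ y) * (√ x * √ y)) (x * y)
    (≃-trans {(√ x * √ y) * (√ x * √ y)} {(√ x * √ x) * (√ y * √ y)} {x * y}
      (≗⇒≃ ((√ x * √ y) * (√ x * √ y)) ((√ x * √ x) * (√ y * √ y)) λ n →
        solve 2 (λ a b → (a :* b) :* (a :* b) := (a :* a) :* (b :* b)) refl (seq (√ x) n) (seq (√ y) n))
      (*-cong {√ x * √ x} {x} {√ y * √ y} {y} (√-square x 0≤x) (√-square y 0≤y)))
    (0≤x² (√ x * √ y))

  0≤⟨f,f⟩ : ∀ {n} (f : Fin n → ℝ) → fromℕ 0 ≤ ⟨ f , f ⟩
  0≤⟨f,f⟩ {zero}  f = seq-≤⇒≤ (fromℕ 0) (fromℕ 0) λ _ → ℚP.≤-refl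
  0≤⟨f,f⟩ {suc n} f = 0≤x+y (f zero * f zero) ⟨ (λ i → f (suc i)) , (λ i → f (suc i)) ⟩
    (0≤x² (f zero)) (0≤⟨f,f⟩ (λ i → f (suc i)))

  -- Here y may be negative, as 2 + ℓ - μ can be: `sq-cancel-<` asks only the larger side to be
  -- nonnegative. With η = ε/2 and s the n-th approximation of the root, the terms satisfy y² < x +
  -- η² ≤ (s + δ)² + η² ≤ (s + δ + η)², and eventually δ < η.
  y²≤x⇒y≤√x : ∀ x y → y * y ≤ x → y ≤ √ x
  y²≤x⇒y≤√x x y y²≤x ε 0<ε =
    let η   = ε ℚ.* ½
        0<η = half-pos 0<ε
        M , h = y²≤x (η ℚ.* η) (*-pos 0<η 0<η)
        N , k = archimedean 0<η
    in M ℕ.+ N , λ n n≥ →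
      let s = √ℚ n (seq x n)
          δ = + 1 ℚ./ suc n
          0≤δ = ℚP.nonNegative⁻¹ δ {{ℚP.normalize-nonNeg 1 (suc n)}}
          0≤s+δ = +-nonneg (√ℚ-nonneg n (seq x n)) 0≤δ
          0≤η = ℚP.<⇒≤ 0<η
          0≤[s+δ]η : 0ℚ ℚ.≤ (s ℚ.+ δ) ℚ.* η
          0≤[s+δ]η = subst (ℚ._≤ (s ℚ.+ δ) ℚ.* η) (ℚP.*-zeroˡ η)
            (ℚP.*-monoʳ-≤-nonNeg η {{ℚ.nonNegative 0≤η}} 0≤s+δ)
      in begin-strict
      seq y n
        <⟨ sq-cancel-< {seq y n} {s ℚ.+ δ ℚ.+ η} (+-nonneg 0≤s+δ 0≤η) (begin-strict
             seq y n ℚ.* seq y n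
               <⟨ h n (ℕP.m+n≤o⇒m≤o M n≥) ⟩
             seq x n ℚ.+ η ℚ.* η
               ≤⟨ ℚP.+-monoˡ-≤ (η ℚ.* η) (ℚP.≤-trans (ℚP.p≤p⊔q (seq x n) 0ℚ) (ℚP.<⇒≤ (proj₂ (√ℚ-spec n (seq x n))))) ⟩
             (s ℚ.+ δ) ℚ.* (s ℚ.+ δ) ℚ.+ η ℚ.* η
               ≡⟨ ℚP.+-identityʳ _ ⟨
             (s ℚ.+ δ) ℚ.* (s ℚ.+ δ) ℚ.+ η ℚ.* η ℚ.+ 0ℚ
               -- The nonnegative cross terms 2(s + δ)η complete the square.
               ≤⟨ ℚP.+-monoʳ-≤ ((s ℚ.+ δ) ℚ.* (s ℚ.+ δ) ℚ.+ η ℚ.* η) (+-nonneg 0≤[s+δ]η 0≤[s+δ]η) ⟩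
             (s ℚ.+ δ) ℚ.* (s ℚ.+ δ) ℚ.+ η ℚ.* η ℚ.+ ((s ℚ.+ δ) ℚ.* η ℚ.+ (s ℚ.+ δ) ℚ.* η)
               ≡⟨ solve 2 (λ u e → u :* u :+ e :* e :+ (u :* e :+ u :* e) := (u :+ e) :* (u :+ e)) refl (s ℚ.+ δ) η ⟩
             (s ℚ.+ δ ℚ.+ η) ℚ.* (s ℚ.+ δ ℚ.+ η) ∎) ⟩
      s ℚ.+ δ ℚ.+ η
        <⟨ ℚP.+-monoˡ-< η (ℚP.+-monoʳ-< s (k n (ℕP.m+n≤o⇒n≤o M n≥))) ⟩
      s ℚ.+ η ℚ.+ η
        ≡⟨ ≡.trans (ℚP.+-assoc s η η) (cong (s ℚ.+_) (half+half ε)) ⟩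
      s ℚ.+ ε ∎
    where open ℚP.≤-Reasoning

-- Strongly regular graphs

module StronglyRegularGraph {G : Graph} {n k ℓ μ : ℕ} (srg : IsSRG G n k ℓ μ) (1≤μ : 1 ℕ.≤ μ) where
  open Graph G
  open IsSRG srg

  commonNeighbour : ∀ {x y} → x ≢ y → ¬ Adj x y → ∃ λ z → Adj x z × Adj y z
  commonNeighbour {x} {y} x≢y ¬a with nonempty? (neighbours G x ∩ neighbours G y)
  ... | yes (z , z∈) =
    let z∈x , z∈y = x∈p∩q⁻ (neighbours G x) (neighbours G y) z∈
    in z , ∈-neighbours⁻ G z∈x , ∈-neighbours⁻ G z∈y
  ... | no empty = contradiction
    (subst (1 ℕ.≤_) (≡.trans (≡.sym (nonadjacent x y x≢y ¬a))
      (≡.trans (cong ∣_∣ (Empty-unique empty)) (∣⊥∣≡0 order))) 1≤μ) λ ()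

  ∈-neighbours⁺ : ∀ {x y} → Adj x y → y ∈ neighbours G x
  ∈-neighbours⁺ {x} {y} a = lookup⇒[]= y (neighbours G x)
    (≡.trans (lookup∘tabulate (λ z → does (adj? x z)) y) (dec-true (adj? x y) a))

  -- For z adjacent to both of the non-adjacent x, y, neither x nor y lies in N(z) ∩ N(x).
  ℓ+2≤k : NonComplete G → suc (suc ℓ) ℕ.≤ k
  ℓ+2≤k (x , y , x≢y , ¬a) =
    let z , xz , yz = commonNeighbour x≢y ¬a
        p = neighbours G z
        q = neighbours G x
        x∈p = ∈-neighbours⁺ (adj-sym xz)
        y∈p∖x = x∈p∧x≢y⇒x∈p-y (∈-neighbours⁺ (adj-sym yz)) (≡.≢-sym x≢y)
        p∩q⊆ : (p ∩ q) ⊆ (p ∖ x) ∖ y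
        p∩q⊆ = λ {u} u∈ →
          let u∈p , u∈q = x∈p∩q⁻ p q u∈
              xu = ∈-neighbours⁻ G u∈q
          in x∈p∧x≢y⇒x∈p-y (x∈p∧x≢y⇒x∈p-y u∈p λ u≡x → adj-irrefl (≡.sym u≡x) xu)
                           (λ u≡y → ¬a (subst (Adj x) u≡y xu))
    in subst₂ (λ i j → suc (suc i) ℕ.≤ j) (adjacent z x (adj-sym xz)) (regular z)
         (ℕP.≤-trans (s≤s (ℕP.≤-trans (s≤s (p⊆q⇒∣p∣≤∣q∣ p∩q⊆)) (x∈p⇒∣p-x∣<∣p∣ y∈p∖x))) (x∈p⇒∣p-x∣<∣p∣ x∈p))

  private
    conn : Connected G
    conn = srg-connected srg 1≤μ

  dist-spec : ∀ x y → Walk G x y (dist G conn x y) × (∀ l → Walk G x y l → dist G conn x y ℕ.≤ l)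
  dist-spec x y = proj₂ (least (walk? G x y) (conn x y))

  dist-≡ : ∀ x → dist G conn x x ≡ 0
  dist-≡ x = ℕP.n≤0⇒n≡0 (proj₂ (dist-spec x x) 0 nil)

  dist-adj : ∀ {x y} → Adj x y → dist G conn x y ≡ 1
  dist-adj {x} {y} a = go (proj₁ (dist-spec x y)) (proj₂ (dist-spec x y) 1 (cons a nil))
    where
    -- The distance is generalised to any `d` carried by a walk, so that matching on the walk
    -- determines its length.
    go : ∀ {d} → Walk G x y d → d ℕ.≤ 1 → d ≡ 1
    go nil        _         = contradiction a (adj-irrefl refl)
    go (cons _ _) (s≤s z≤n) = refl

  dist-nonadj : ∀ {x y} → x ≢ y → ¬ Adj x y → dist G conn x y ≡ 2
  dist-nonadj {x} {y} x≢y ¬a =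
    let z , xz , yz = commonNeighbour x≢y ¬a
    in go (proj₁ (dist-spec x y)) (proj₂ (dist-spec x y) 2 (cons xz (cons (adj-sym yz) nil)))
    where
    -- The walk through a common neighbour caps the length at 2; shorter ones would force x = y or
    -- an edge.
    go : ∀ {d} → Walk G x y d → d ℕ.≤ 2 → d ≡ 2
    go nil                 _               = contradiction refl x≢y
    go (cons a nil)        _               = contradiction a ¬a
    go (cons _ (cons _ _)) (s≤s (s≤s z≤n)) = refl

  adjacency : V → V → Bool
  adjacency x y = does (adj? x y)

  adjacency-sym : ∀ x y → adjacency x y ≡ adjacency y x
  adjacency-sym x y with adj? y x
  ... | yes a = dec-true (adj? x y) (adj-sym a)
  ... | no ¬a = dec-false (adj? x y) λ a → ¬a (adj-sym a)

  adjacency-irrefl : ∀ x → adjacency x x ≡ false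
  adjacency-irrefl x = dec-false (adj? x x) (adj-irrefl refl)

  adjacency⇒Adj : ∀ x y → adjacency x y ≡ true → Adj x y
  adjacency⇒Adj x y axy with yes a ← adj? x y = a

  nonadjacency⇒¬Adj : ∀ x y → adjacency x y ≡ false → ¬ Adj x y
  nonadjacency⇒¬Adj x y axy with no ¬a ← adj? x y = ¬a

-- Since s² = q, the inverse of s(s + c) is s(s − c) / (q(q − c²)); r is its square root.
normaliser : ∀ q c s → c ℚ.* c ℚ.< q → fromℕ 0 ≤ s → fromℚ c ≤ s → s * s ≃ fromℚ q →
             ∃ λ r → r * r * (s * (s + fromℚ c)) ≃ fromℕ 1
normaliser q c s c²<q 0≤s c≤s s²≃q = √ w , (begin
  √ w * √ w * N
    ≈⟨ CommutativeRing.*-congʳ ℝ-commutativeRing {N} {√ w * √ w} {w} (√-square w 0≤w) ⟩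
  w * N
    ≈⟨ ≗⇒≃ (w * N) (fromℚ t * (s * s * (s * s - C * C))) (λ n →
         solve 3 (λ t s c → t :* (s :* (s :- c)) :* (s :* (s :+ c)) := t :* (s :* s :* (s :* s :- c :* c)))
           refl t (seq s n) c) ⟩
  fromℚ t * (s * s * (s * s - C * C))
    ≈⟨ *-congˡ (fromℚ t) {s * s * (s * s - C * C)} {Q * (Q - C * C)}
         (*-cong {s * s} {Q} {s * s - C * C} {Q - C * C} s²≃q
           (+-cong {s * s} {Q} {(- (C * C))} {(- (C * C))} s²≃q (≃-refl {(- (C * C))}))) ⟩
  fromℚ t * (Q * (Q - C * C))
    ≈⟨ ≗⇒≃ (fromℚ t * (Q * (Q - C * C))) (fromℕ 1) (λ _ → ℚP.*-inverseˡ d) ⟩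
  fromℕ 1 ∎)
  where
  open +-*-Solver using (solve; _:+_; _:*_; _:-_; _:=_)
  open import Relation.Binary.Reasoning.Setoid (CommutativeRing.setoid ℝ-commutativeRing)
  d = q ℚ.* (q ℚ.- c ℚ.* c)
  0<d : 0ℚ ℚ.< d
  0<d = *-pos (ℚP.≤-<-trans (p²≥0 c) c²<q)
    (subst (ℚ._< q ℚ.- c ℚ.* c) (ℚP.+-inverseʳ (c ℚ.* c)) (ℚP.+-monoˡ-< (ℚ.- (c ℚ.* c)) c²<q))
  instance
    d-positive : ℚ.Positive d
    d-positive = ℚ.positive 0<d
    d-nonZero : ℚ.NonZero d
    d-nonZero = ℚP.pos⇒nonZero d
  t = ℚ.1/ d
  Q = fromℚ q
  C = fromℚ c
  N = s * (s + C)
  w = fromℚ t * (s * (s - C))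
  0≤t : fromℕ 0 ≤ fromℚ t
  0≤t = seq-≤⇒≤ (fromℕ 0) (fromℚ t) λ _ → ℚP.<⇒≤ (ℚP.positive⁻¹ t {{ℚP.1/pos⇒pos d}})
  0≤w : fromℕ 0 ≤ w
  0≤w = 0≤x*y (fromℚ t) (s * (s - C)) 0≤t (0≤x*y s (s - C) 0≤s (x≤y⇒0≤y-x C s c≤s))

-- The maximum over the reals

⟨𝟙,_⟩ : ∀ {n} (f : Fin n → ℝ) → ⟨ 𝟙 , f ⟩ ≃ sum f
⟨𝟙,_⟩ {n} f = Algebra.Properties.Semiring.Sum.sum-cong-≋ (CommutativeRing.semiring ℝ-commutativeRing) {n}
  {λ x → 𝟙 {n} x * f x} {f} λ x → CommutativeRing.*-identityˡ ℝ-commutativeRing (f x)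

-- Distances enter only through the values 0, 1 and 2 on the three relations, so `D` is any matrix
-- with these values. The work here is to supply s, 1/s² and the normalising scalar as actual reals.
maximum-on-𝟙^⊥ : ∀ {G n k ℓ μ} (srg : IsSRG G n k ℓ μ) (1≤μ : 1 ℕ.≤ μ) → NonComplete G →
  (D : Graph.V G → Graph.V G → ℝ) → (∀ x → D x x ≃ fromℕ 0) →
  (∀ {x y} → Graph.Adj G x y → D x y ≃ fromℕ 1) →
  (∀ {x y} → x ≢ y → ¬ Graph.Adj G x y → D x y ≃ fromℕ 2) →
  IsMaximum (λ (f : Graph.V G → ℝ) → ⟨ f , f ⟩ ≃ fromℕ 1 × ⟨ 𝟙 , f ⟩ ≃ fromℕ 0) (λ f → ⟨ f , D · f ⟩)
    (- fromℕ 2 - ((fromℕ ℓ - fromℕ μ) - √ ((fromℕ ℓ - fromℕ μ) * (fromℕ ℓ - fromℕ μ) + fromℕ 4 * (fromℕ k - fromℕ μ))) /2)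
maximum-on-𝟙^⊥ {G} {n} {k} {ℓ} {μ} srg 1≤μ nonComplete@(x , y , x≢y , ¬xy) D D-diagonal D-adjacent D-nonadjacent =
  attained , upper
  where
  open +-*-Solver using (solve; _:+_; _:*_; _:-_; _:=_; con)
  open StronglyRegularGraph srg 1≤μ
  module R = RationalAlgebra ℝ-commutativeRing fromℚ-homomorphism
  b m Δ s : ℝ
  b = fromℕ ℓ - fromℕ μ
  m = fromℕ k - fromℕ μ
  Δ = b * b + fromℕ 4 * m
  s = √ Δ
  q c j : ℚ
  -- The sequence of Δ is constant, so its term 0 is the exact rational value of Δ.
  q = seq Δ 0
  c = ℕ→ℚ 2 ℚ.+ (ℕ→ℚ ℓ ℚ.- ℕ→ℚ μ)
  -- By `ℓ+2≤k` the truncated subtraction is exact, so 1 + j = k - ℓ - 1.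
  j = ℕ→ℚ (k ℕ.∸ suc (suc ℓ))
  k≡ : ℕ→ℚ k ≡ ℕ→ℚ 2 ℚ.+ ℕ→ℚ ℓ ℚ.+ j
  k≡ = ≡.trans (cong ℕ→ℚ (≡.sym (ℕP.m+[n∸m]≡n (ℓ+2≤k nonComplete))))
    (≡.trans (ℕ→ℚ-+ (2 ℕ.+ ℓ) (k ℕ.∸ suc (suc ℓ))) (cong (ℚ._+ j) (ℕ→ℚ-+ 2 ℓ)))
  0<4[1+j] : 0ℚ ℚ.< ℕ→ℚ 4 ℚ.* (1ℚ ℚ.+ j)
  0<4[1+j] = *-pos (ℚP.positive⁻¹ (ℕ→ℚ 4)) (ℚP.+-mono-<-≤ (ℚP.positive⁻¹ 1ℚ) (ℕ→ℚ-nonneg (k ℕ.∸ suc (suc ℓ))))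
  -- Δ − (ℓ − μ + 2)² = 4(k − ℓ − 1).
  c²<q : c ℚ.* c ℚ.< q
  c²<q = subst₂ ℚ._<_ (ℚP.+-identityʳ (c ℚ.* c))
    (≡.trans (solve 3 (λ l m j →
        (con (ℕ→ℚ 2) :+ (l :- m)) :* (con (ℕ→ℚ 2) :+ (l :- m)) :+ con (ℕ→ℚ 4) :* (con 1ℚ :+ j)
        := (l :- m) :* (l :- m) :+ con (ℕ→ℚ 4) :* (con (ℕ→ℚ 2) :+ l :+ j :- m)) refl (ℕ→ℚ ℓ) (ℕ→ℚ μ) j)
      (cong (λ k → (ℕ→ℚ ℓ ℚ.- ℕ→ℚ μ) ℚ.* (ℕ→ℚ ℓ ℚ.- ℕ→ℚ μ) ℚ.+ ℕ→ℚ 4 ℚ.* (k ℚ.- ℕ→ℚ μ)) (≡.sym k≡)))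
    (ℚP.+-monoʳ-< (c ℚ.* c) 0<4[1+j])
  0<q : 0ℚ ℚ.< q
  0<q = ℚP.≤-<-trans (p²≥0 c) c²<q
  instance
    q-positive : ℚ.Positive q
    q-positive = ℚ.positive 0<q
    q-nonZero : ℚ.NonZero q
    q-nonZero = ℚP.pos⇒nonZero q
  -- T = 1/Δ serves as the inverse t of s² in `maximum-gap`.
  T : ℝ
  T = fromℚ (ℚ.1/ q)
  0≤T : fromℕ 0 ≤ T
  0≤T = seq-≤⇒≤ (fromℕ 0) T λ _ → ℚP.<⇒≤ (ℚP.positive⁻¹ (ℚ.1/ q) {{ℚP.1/pos⇒pos q}})
  s²≃Δ : s * s ≃ Δ
  s²≃Δ = √-square Δ (seq-≤⇒≤ (fromℕ 0) Δ λ _ → ℚP.<⇒≤ 0<q)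
  Ts²≃1 : T * (s * s) ≃ fromℕ 1
  Ts²≃1 = ≃-trans {T * (s * s)} {T * Δ} {fromℕ 1} (*-congˡ T {s * s} {Δ} s²≃Δ)
    (≗⇒≃ (T * Δ) (fromℕ 1) λ _ → ℚP.*-inverseˡ q)
  r,norm : ∃ λ r → r * r * (s * (s + fromℚ c)) ≃ fromℕ 1
  r,norm = normaliser q c s c²<q (√-nonneg Δ)
    (y²≤x⇒y≤√x Δ (fromℚ c) (seq-≤⇒≤ (fromℚ c * fromℚ c) Δ λ _ → ℚP.<⇒≤ c²<q))
    (≃-trans {s * s} {Δ} {fromℚ q} s²≃Δ (≗⇒≃ Δ (fromℚ q) λ _ → refl))
  r : ℝ
  r = proj₁ r,norm
  -- A common neighbour of the non-adjacent pair gives the edge from x to z on which the maximiser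
  -- is built.
  xzy : ∃ λ z → Graph.Adj G x z × Graph.Adj G y z
  xzy = commonNeighbour x≢y ¬xy
  z = proj₁ xzy
  module S = R.StronglyRegular adjacency adjacency-sym adjacency-irrefl k ℓ μ
    (IsSRG.regular srg)
    (λ x y axy → IsSRG.adjacent srg x y (adjacency⇒Adj x y axy))
    (λ x y x≢y axy → IsSRG.nonadjacent srg x y x≢y (nonadjacency⇒¬Adj x y axy))
    D D-diagonal
    (λ x y axy → D-adjacent (adjacency⇒Adj x y axy))
    (λ x y x≢y axy → D-nonadjacent x≢y (nonadjacency⇒¬Adj x y axy))
    s s²≃Δ
  C : ℝ
  C = - fromℕ 2 - (b - s) /2
  -- `fromℚ c` and `fromℕ 2 + b` are the same constant sequence, and `_≃_` looks only at sequences.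
  r-normalises : r * r * (s * (s + (fromℕ 2 + b))) ≃ fromℕ 1
  r-normalises = proj₂ r,norm
  fromUnit : (∃ λ f → (⟨ f , f ⟩ ≃ fromℕ 1 × sum f ≃ fromℕ 0) ×
                      (∀ g → (∀ x → g x ≃ (D · f) x) → ⟨ f , g ⟩ ≃ C)) →
             ∃ λ f → (⟨ f , f ⟩ ≃ fromℕ 1 × ⟨ 𝟙 , f ⟩ ≃ fromℕ 0) × ⟨ f , D · f ⟩ ≃ C
  fromUnit (f , (⟨f,f⟩≃1 , ∑f≃0) , value) =
    f , (⟨f,f⟩≃1 , ≃-trans {⟨ 𝟙 , f ⟩} {sum f} {fromℕ 0} ⟨𝟙, f ⟩ ∑f≃0) , value (D · f) λ x → ≃-refl {(D · f) x}
  attained : ∃ λ f → (⟨ f , f ⟩ ≃ fromℕ 1 × ⟨ 𝟙 , f ⟩ ≃ fromℕ 0) × ⟨ f , D · f ⟩ ≃ C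
  attained = fromUnit (S.maximum-attained r r-normalises x z (dec-true (Graph.adj? G x z) (proj₁ (proj₂ xzy))))
  fromGap : ∀ v → (∃ λ (h : Graph.V G → ℝ) → C - v ≃ T * s * ⟨ h , h ⟩) → v ≤ C
  fromGap v (h , gap) = 0≤y-x⇒x≤y v C (≤-respʳ-≃ (fromℕ 0) (T * s * ⟨ h , h ⟩) (C - v)
    (≃-sym {C - v} {T * s * ⟨ h , h ⟩} gap)
    (0≤x*y (T * s) ⟨ h , h ⟩ (0≤x*y T s 0≤T (√-nonneg Δ)) (0≤⟨f,f⟩ h)))
  upper : ∀ f → ⟨ f , f ⟩ ≃ fromℕ 1 × ⟨ 𝟙 , f ⟩ ≃ fromℕ 0 → ⟨ f , D · f ⟩ ≤ C
  upper f (⟨f,f⟩≃1 , f⊥1) = fromGap ⟨ f , D · f ⟩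
    (S.maximum-gap T Ts²≃1 f (D · f) (λ x → ≃-refl {(D · f) x}) ⟨f,f⟩≃1
      (≃-trans {sum f} {⟨ 𝟙 , f ⟩} {fromℕ 0} (≃-sym {⟨ 𝟙 , f ⟩} {sum f} ⟨𝟙, f ⟩) f⊥1))

theorem1p1 : (G : Graph) (n k ℓ μ : ℕ) (srg : IsSRG G n k ℓ μ) (1≤μ : 1 ℕ.≤ μ) →
    NonComplete G →
    IsQEC G (srg-connected srg 1≤μ)
    (- fromℕ 2 - ((fromℕ ℓ - fromℕ μ) - √ ((fromℕ ℓ - fromℕ μ) * (fromℕ ℓ - fromℕ μ) + fromℕ 4 * (fromℕ k - fromℕ μ))) /2)
theorem1p1 G n k ℓ μ srg 1≤μ nonComplete =
  maximum-on-𝟙^⊥ srg 1≤μ nonComplete (distanceMatrix G (srg-connected srg 1≤μ))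
    (λ x → ≗⇒≃ (distanceMatrix G (srg-connected srg 1≤μ) x x) (fromℕ 0) λ _ → cong ℕ→ℚ (dist-≡ x))
    (λ {x} {y} a → ≗⇒≃ (distanceMatrix G (srg-connected srg 1≤μ) x y) (fromℕ 1) λ _ → cong ℕ→ℚ (dist-adj a))
    (λ {x} {y} x≢y ¬a → ≗⇒≃ (distanceMatrix G (srg-connected srg 1≤μ) x y) (fromℕ 2) λ _ →
      cong ℕ→ℚ (dist-nonadj x≢y ¬a))
  where open StronglyRegularGraph srg 1≤μ
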